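{- Let $n=2^rp$, where $p$ is an odd prime and $r\ge 2$. Let $S$ be a sequence in $\mathbb{Z}_n$ which has exactly two odd terms. Then $S$ is a $U(n)$-extremal sequence for the Gao constant if and only if there exist primes $p_1,\ldots,p_r$ with $n=2p_1p_2\cdots p_r$ (in some order), integers $b_1,\ldots,b_r$ with $b_i$ coprime to $p_i$ for each $1\le i\le r$, and an odd integer $m$ with $1\le m\le n$, such that $S$ is $U(n)$-equivalent to the sequence $$(b_1,\ p_1b_2,\ p_1p_2b_3,\ \ldots,\ p_1\cdots p_{r-1}b_r,\ \underbrace{n/2,\ldots,n/2}_{m\text{ times}},\ \underbrace{0,\ldots,0}_{n-m\text{ times}}).$$
   Context: $\mathbb{Z}_n=\mathbb{Z}/n\mathbb{Z}$ and $U(n)$ is its group of units; integers are identified with their images in $\mathbb{Z}_n$. For even $n$, an element of $\mathbb{Z}_n$ is odd if it is the image of an odd integer; terms of a sequence are counted with multiplicity. A sequence is a finite list $(x_1,\ldots,x_l)$ of elements of $\mathbb{Z}_n$ (repetitions allowed); a subsequence is obtained by restricting to a subset of the indices. For $A\subseteq\mathbb{Z}_n$, a subsequence of $(x_1,\ldots,x_l)$ with index set $I$ is an $A$-weighted zero-sum subsequence if $I\ne\emptyset$ and there exist $a_i\in A$ ($i\in I$) with $\sum_{i\in I}a_ix_i=0$. The $A$-weighted Gao constant $E_A(n)$ is the least positive integer $k$ such that every sequence of length $k$ in $\mathbb{Z}_n$ has an $A$-weighted zero-sum subsequence of length $n$. An $A$-extremal sequence for the Gao constant is a sequence in $\mathbb{Z}_n$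 of length $E_A(n)-1$ which has no $A$-weighted zero-sum subsequence of length $n$. For a subgroup $A$ of $U(n)$, two sequences $(x_1,\ldots,x_l)$ and $(y_1,\ldots,y_l)$ in $\mathbb{Z}_n$ are $A$-equivalent if there exist $c\in U(n)$, a permutation $\sigma$ of $\{1,\ldots,l\}$ and $a_1,\ldots,a_l\in A$ such that $c\,y_{\sigma(i)}=a_ix_i$ for all $1\le i\le l$. -}

module Defs where

open import Algebra.Definitions using (Invertible)
open import Data.Bool.Base using (if_then_else_)
open import Data.Fin.Base using (Fin; toℕ)
open import Data.Fin.Permutation using (Permutation; _⟨$⟩ʳ_)
open import Data.Fin.Subset using (Subset; Nonempty; ∣_∣; _∈_)
open import Data.Integer.Base as ℤ using (ℤ; +_; 0ℤ; 1ℤ; _%ℕ_)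
import Data.Integer.Divisibility as ℤ
import Data.List.Base as List
open import Data.Nat.Base as ℕ using (ℕ; NonZero; _∸_; _≤_)
open import Data.Nat.DivMod using (_mod_; _/_)
open import Data.Nat.ListAction using (product)
open import Data.Product.Base using (_×_; ∃-syntax; Σ-syntax)
open import Data.Vec.Base using (Vec; lookup; tabulate; replicate; toList; foldr′; _++_)
open import Function.Bundles using (_⇔_)
open import Level using (0ℓ)
open import Relation.Binary.PropositionalEquality.Core using (_≡_)
open import Relation.Nullary.Negation.Core using (¬_)
open import Relation.Unary using (Pred)

-- ℤ/nℤ, each class being represented by its residue in {0, …, n - 1}.
ℤ/_ : ℕ → Set
ℤ/ n = Fin n

infixl 6 _+ₙ_
infixl 7 _*ₙ_

_+ₙ_ _*ₙ_ : ∀ {n} .{{_ : NonZero n}} → ℤ/ n → ℤ/ n → ℤ/ n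
_+ₙ_ {n} x y = (toℕ x ℕ.+ toℕ y) mod n
_*ₙ_ {n} x y = (toℕ x ℕ.* toℕ y) mod n

ι : ∀ {n} .{{_ : NonZero n}} → ℤ → ℤ/ n
ι {n} z = (z %ℕ n) mod n

U : ∀ n .{{_ : NonZero n}} → Pred (ℤ/ n) 0ℓ
U n = Invertible _≡_ (ι 1ℤ) _*ₙ_

-- Meaningful only for even n: for odd n every class contains an odd integer.
OddClass : ∀ {n} .{{_ : NonZero n}} → Pred (ℤ/ n) 0ℓ
OddClass x = ∃[ z ] (¬ (+ 2 ℤ.∣ z)) × ι z ≡ x

-- Exactly k indices i satisfy P (xᵢ), so terms are counted with multiplicity.
HasExactly : ∀ {X : Set} {l} → ℕ → Pred X 0ℓ → Vec X l → Set
HasExactly {l = l} k P xs =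
  ∃[ I ] ∣ I ∣ ≡ k × ((i : Fin l) → i ∈ I ⇔ P (lookup xs i))

weightedSum : ∀ {n l} .{{_ : NonZero n}} →
              Subset l → (Fin l → ℤ/ n) → Vec (ℤ/ n) l → ℤ/ n
weightedSum I a xs =
  foldr′ _+ₙ_ (ι 0ℤ)
    (tabulate λ i → if lookup I i then a i *ₙ lookup xs i else ι 0ℤ)

-- The weights aᵢ with i ∉ I are unconstrained and do not enter the sum.
IsZeroSumSubsequence : ∀ {n l} .{{_ : NonZero n}} →
                       Pred (ℤ/ n) 0ℓ → Vec (ℤ/ n) l → Subset l → Set
IsZeroSumSubsequence {n} {l} A xs I =
  Nonempty I ×
  (Σ[ a ∈ (Fin l → ℤ/ n) ] ((i : Fin l) → i ∈ I → A (a i)) × weightedSum I a xs ≡ ι 0ℤ)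

HasZeroSumSubsequenceOfLength : ∀ {n l} .{{_ : NonZero n}} →
                                ℕ → Pred (ℤ/ n) 0ℓ → Vec (ℤ/ n) l → Set
HasZeroSumSubsequenceOfLength k A xs =
  ∃[ I ] ∣ I ∣ ≡ k × IsZeroSumSubsequence A xs I

GaoProperty : ∀ n .{{_ : NonZero n}} → Pred (ℤ/ n) 0ℓ → ℕ → Set
GaoProperty n A k =
  (xs : Vec (ℤ/ n) k) → HasZeroSumSubsequenceOfLength n A xs

-- IsGaoConstant n A E says that E = E_A(n).
IsGaoConstant : ∀ n .{{_ : NonZero n}} → Pred (ℤ/ n) 0ℓ → ℕ → Set
IsGaoConstant n A E =
  1 ≤ E × GaoProperty n A E × (∀ k → 1 ≤ k → GaoProperty n A k → E ≤ k)

IsGaoExtremal : ∀ {n l} .{{_ : NonZero n}} →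
                Pred (ℤ/ n) 0ℓ → Vec (ℤ/ n) l → Set
IsGaoExtremal {n} {l} A xs =
  ∃[ E ] IsGaoConstant n A E × l ≡ E ∸ 1 ×
         ¬ HasZeroSumSubsequenceOfLength n A xs

-- A Permutation l l′ is a bijection Fin l ↔ Fin l′, so it forces l ≡ l′.
Equivalent : ∀ {n l l′} .{{_ : NonZero n}} →
             Pred (ℤ/ n) 0ℓ → Vec (ℤ/ n) l → Vec (ℤ/ n) l′ → Set
Equivalent {n} {l} {l′} A xs ys =
  ∃[ c ] U n c ×
  (Σ[ σ ∈ Permutation l l′ ] Σ[ a ∈ (Fin l → ℤ/ n) ] ((i : Fin l) → A (a i)) ×
    ((i : Fin l) → c *ₙ lookup ys (σ ⟨$⟩ʳ i) ≡ a i *ₙ lookup xs i))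

-- (b₁, p₁b₂, p₁p₂b₃, …, p₁⋯pᵣ₋₁bᵣ, n/2, …, n/2, 0, …, 0), with n/2 repeated
-- m times and 0 repeated n - m times.
standardSequence : ∀ n .{{_ : NonZero n}} {r} →
                   Vec ℕ r → Vec ℤ r → (m : ℕ) →
                   Vec (ℤ/ n) (r ℕ.+ (m ℕ.+ (n ∸ m)))
standardSequence n ps bs m =
  tabulate (λ i → ι (+ product (List.take (toℕ i) (toList ps)) ℤ.* lookup bs i))
  ++ replicate m (ι (+ (n / 2)))
  ++ replicate (n ∸ m) (ι 0ℤ)

{-# OPTIONS --safe #-}

-- With n = 2^r p, a set of terms has a U(n)-weighted zero sum iff it has one modulo 2^r with odd
-- weights (no term is nonzero modulo 2^r, or the terms of least 2-adic valuation are even in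
-- number) and one modulo p with weights prime to p (the number of terms prime to p is not 1).
-- So everything depends only on the 2-adic valuations and on which terms are prime to p.
-- Descending through the valuations, dropping a term that is alone on its level and otherwise
-- keeping an even number of terms of the level, shows that n + r + 1 terms always contain n
-- solvable ones. If there are only n + r terms, none of them solvable, and exactly two are odd,
-- then keeping both odd terms forces exactly one term of the sequence to be prime to p, and it is
-- odd; the descent through the others, all divisible by p, leaves a single term on each level
-- 2^i p with i < r - 1 and an odd number of terms n/2. So p₁ = p, p₂ = … = pᵣ = 2, and the
-- sequence is a permutation of a standard one.
-- Conversely the first used term among p₁⋯pᵢ₋₁bᵢ is the only one not divisible by p₁⋯pᵢ, hence
-- none is used, and an odd number of terms n/2 with odd weights does not sum to zero.

module Submission where

open import Data.Bool.Base using (if_then_else_)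
open import Data.Fin.Base as Fin using (Fin; zero; suc; toℕ; punchIn)
open import Data.Fin.Permutation as Perm using (Permutation; _⟨$⟩ʳ_; _∘ₚ_; cast-id; ↔⇒≡)
open import Data.Fin.Properties using (toℕ-fromℕ<; toℕ-injective; toℕ<n)
open import Data.Fin.Subset using (Subset; Nonempty; inside; outside) renaming (_∈_ to _∈ₛ_; ∣_∣ to ∥_∥)
open import Data.Integer.Base as ℤ using (ℤ; +_; 0ℤ; 1ℤ; _%ℕ_)
open import Data.Integer.Coprimality using (Coprime)
import Data.Integer.DivMod as ℤ
import Data.Integer.Divisibility.Signed as ℤ
import Data.Integer.Properties as ℤ
open import Data.List.Base as List using (List; []; _∷_; _++_; length; take; drop)
open import Data.List.Properties using (length-++; length-take; length-replicate; take++drop≡id; ++-identityʳ; ++-assoc)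
open import Data.List.Relation.Binary.Permutation.Homogeneous using (onIndices)
open import Data.List.Relation.Binary.Permutation.Propositional
  using (_↭_; refl; prep; swap; ↭-refl; ↭-sym; ↭-trans; ↭-reflexive; ↭⇒↭ₛ)
  renaming (trans to ↭-step)
open import Data.List.Relation.Binary.Permutation.Propositional.Properties
  using (All-resp-↭; ↭-length; ++⁺; ++⁺ˡ; ++⁺ʳ; shift; shifts)
  renaming (++-comm to ↭-++-comm)
import Data.List.Relation.Binary.Permutation.Setoid.Properties as ↭ₛ
open import Data.List.Relation.Binary.Pointwise using (Pointwise-≡⇒≡)
open import Data.List.Relation.Binary.Sublist.Heterogeneous.Properties using (toPointwise)
open import Data.List.Relation.Binary.Sublist.Propositional using (_⊆_; []; _∷_; _∷ʳ_; ⊆-refl; ⊆-trans; minimum)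
open import Data.List.Relation.Binary.Sublist.Propositional.Properties using (All-resp-⊆) renaming (++⁺ʳ to ⊆-++⁺ʳ)
open import Data.List.Relation.Unary.All as All using (All; []; _∷_)
open import Data.List.Relation.Unary.All.Properties using (++⁻ˡ; ++⁻ʳ; replicate⁺) renaming (++⁺ to All-++⁺)
open import Data.Nat.Base
import Data.Nat.Coprimality as ℕ
open import Data.Nat.Divisibility
open import Data.Nat.DivMod
open import Data.Nat.GCD using (module Bézout)
open import Data.Nat.ListAction using (product)
open import Data.Nat.Primality
open import Data.Nat.Properties
open import Algebra.Properties.CommutativeSemigroup +-commutativeSemigroup using (x∙yz≈y∙xz; x∙yz≈xz∙y)
open import Data.Nat.Tactic.RingSolver using (solve-∀)
open import Data.Product.Base using (_×_; _,_; ∃-syntax; Σ-syntax; proj₁; proj₂)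
open import Data.Sum.Base using (_⊎_; inj₁; inj₂; [_,_]′)
open import Data.Vec.Base as Vec using (Vec; []; _∷_; toList; lookup; tabulate; replicate; truncate; here; there)
open import Data.Vec.Properties using (length-toList; lookup-replicate; lookup∘tabulate; tabulate-cong; tabulate∘lookup; toList-++)
open import Function.Base using (_∘_; case_of_)
open import Function.Bundles using (_⇔_; mk⇔; Equivalence)
open import Level using (0ℓ)
open import Relation.Binary.PropositionalEquality
open import Relation.Nullary using (¬_; Dec; yes; no; contradiction; ¬?)
open import Relation.Nullary.Decidable using (decidable-stable)
open import Relation.Unary using (Pred; Decidable)
open import Defs

-- Inclusion of lists up to permutation.

private variable
  A : Set
  xs ys zs ws : List A

infix 3 _≼_

-- Inclusion of multisets. The complement is carried as a witness, so the order of terms matters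
-- only when an index set has to be produced.
_≼_ : List A → List A → Set
ys ≼ xs = ∃[ zs ] xs ↭ ys ++ zs

≼-reflexive : xs ↭ ys → ys ≼ xs
≼-reflexive xs↭ys = [] , ↭-trans xs↭ys (↭-reflexive (sym (++-identityʳ _)))

≼-refl : xs ≼ xs
≼-refl = ≼-reflexive ↭-refl

≼-trans : xs ≼ ys → ys ≼ zs → xs ≼ zs
≼-trans {xs = xs} (us , p) (vs , q) =
  us ++ vs , ↭-trans q (↭-trans (++⁺ʳ vs p) (↭-reflexive (++-assoc xs us vs)))

≼-++ˡ : ∀ xs {ys : List A} → xs ≼ xs ++ ys
≼-++ˡ xs {ys} = ys , ↭-refl

≼-++ʳ : ∀ xs {ys : List A} → ys ≼ xs ++ ys
≼-++ʳ xs {ys} = xs , ↭-trans (↭-reflexive (cong (xs ++_) (sym (++-identityʳ ys))))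
  (↭-trans (shifts xs ys) (↭-reflexive (cong (ys ++_) (++-identityʳ xs))))

≼-++⁺ : xs ≼ ys → zs ≼ ws → xs ++ zs ≼ ys ++ ws
≼-++⁺ {xs = xs} {zs = zs} (us , p) (vs , q) = us ++ vs ,
  ↭-trans (++⁺ p q) (↭-trans (↭-reflexive (++-assoc xs us (zs ++ vs)))
    (↭-trans (++⁺ˡ xs (shifts us zs)) (↭-reflexive (sym (++-assoc xs zs (us ++ vs))))))

≼-∷⁺ : ∀ (x : A) → xs ≼ ys → x ∷ xs ≼ x ∷ ys
≼-∷⁺ x (us , p) = us , prep x p

≼-∷ʳ : ∀ (x : A) → xs ≼ ys → xs ≼ x ∷ ys
≼-∷ʳ x p = ≼-trans p (≼-++ʳ (x ∷ []))

≼-[] : [] ≼ xs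
≼-[] {xs = xs} = xs , ↭-refl

All-≼ : ∀ {P : Pred A 0ℓ} → ys ≼ xs → All P xs → All P ys
All-≼ {ys = ys} (_ , p) Pxs = ++⁻ˡ ys (All-resp-↭ p Pxs)

++-interchange : ∀ {xs V H : List A} V₁ {V₂} H₁ {H₂} → xs ↭ V ++ H → V ↭ V₁ ++ V₂ → H ↭ H₁ ++ H₂ →
                 xs ↭ (V₁ ++ H₁) ++ (V₂ ++ H₂)
++-interchange V₁ {V₂} H₁ {H₂} p q r = ↭-trans p (↭-trans (++⁺ q r)
  (↭-trans (↭-reflexive (++-assoc V₁ V₂ (H₁ ++ H₂))) (↭-trans (++⁺ˡ V₁ (shifts V₂ H₁))
    (↭-reflexive (sym (++-assoc V₁ H₁ (V₂ ++ H₂)))))))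

Choice : ℕ → Pred (List A) 0ℓ → Pred (List A) 0ℓ
Choice n P xs = ∃[ ys ] ys ≼ xs × length ys ≡ n × P ys

Choice-≼ : ∀ {n} {P : Pred (List A) 0ℓ} → xs ≼ ys → Choice n P xs → Choice n P ys
Choice-≼ s (us , t , l , Pus) = us , ≼-trans t s , l , Pus

choose : ∀ t (xs : List A) → t ≤ length xs → ∃[ ys ] ys ≼ xs × length ys ≡ t
choose t xs t≤ = take t xs ,
  (drop t xs , ↭-reflexive (sym (take++drop≡id t xs))) ,
  trans (length-take t xs) (m≤n⇒m⊓n≡m t≤)

split : ∀ {P : Pred A 0ℓ} → Decidable P → ∀ xs →
        ∃[ ys ] ∃[ zs ] xs ↭ ys ++ zs × All (λ x → ¬ P x) ys × All P zs
split P? [] = [] , [] , ↭-refl , [] , []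
split P? (x ∷ xs) with P? x | split P? xs
... | no ¬px | ys , zs , p , ays , azs = x ∷ ys , zs , prep x p , ¬px ∷ ays , azs
... | yes px | ys , zs , p , ays , azs =
  ys , x ∷ zs , ↭-trans (prep x p) (↭-sym (shift x ys zs)) , ays , px ∷ azs

length-↭-++ : ∀ {xs : List A} ys {zs} → xs ↭ ys ++ zs → length xs ≡ length ys + length zs
length-↭-++ ys p = trans (↭-length p) (length-++ ys)

2∤⇒2∣suc : ∀ {m} → ¬ 2 ∣ m → 2 ∣ suc m
2∤⇒2∣suc {zero} odd = contradiction (2 ∣0) odd
2∤⇒2∣suc {suc zero} odd = ∣-refl
2∤⇒2∣suc {suc (suc m)} odd = ∣m∣n⇒∣m+n (∣-refl {2}) (2∤⇒2∣suc λ 2∣m → odd (∣m∣n⇒∣m+n (∣-refl {2}) 2∣m))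

2∣2+_ : ∀ {k} → 2 ∣ k → 2 ∣ 2 + k
2∣2+ d = ∣m∣n⇒∣m+n ∣-refl d

-- Take as much as possible from `H` and the missing `g` terms from `V`. If `g` is odd, one term of
-- `H` is exchanged for one more of `V`; the strict bound on `t` guarantees that this term exists.
-- With `H` empty no exchange is possible, but then `g` is `t`, which is even by `inj₁`.
even-choice : ∀ t (V H : List A) → suc t ≤ length V + length H → 2 ∣ t ⊎ 1 ≤ length H →
  ∃[ V′ ] ∃[ H′ ] V′ ≼ V × H′ ≼ H × 2 ∣ length V′ × length V′ + length H′ ≡ t
even-choice t V H t< par with t ≤? length H
... | yes t≤ = let H′ , s , l = choose t H t≤ in [] , H′ , ≼-[] , s , 2 ∣0 , l
... | no t≰ with t ∸ length H | m∸n+n≡m (<⇒≤ (≰⇒> t≰))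
...   | g | refl with 2 ∣? g
...     | yes ev = let V′ , s , l = choose g V (<⇒≤ (+-cancelʳ-≤ (length H) (suc g) (length V) t<)) in
            V′ , H , s , ≼-refl , subst (2 ∣_) (sym l) ev , cong (_+ length H) l
...     | no odd with H | par
...       | [] | inj₁ ev = contradiction (subst (2 ∣_) (+-identityʳ g) ev) odd
...       | h ∷ H″ | _ =
            let V′ , s , l = choose (suc g) V (+-cancelʳ-≤ (suc (length H″)) (suc g) (length V) t<) in
            V′ , H″ , s , ≼-++ʳ (h ∷ []) , subst (2 ∣_) (sym l) (2∤⇒2∣suc odd) ,
            trans (cong (_+ length H″) l) (sym (+-suc g (length H″)))

-- The choice of n solvable terms

-- L k stands for divisibility by 2^(r - k), and E for being prime to p.
module Selection
  (L : ℕ → Pred A 0ℓ) (L? : ∀ k → Decidable (L k))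
  (E : Pred A 0ℓ) (E? : Decidable E)
  (m : ℕ) (2∣m : 2 ∣ m) where

  -- At most four terms are fixed in advance, two of least valuation and two prime to p; the other
  -- `m` are filled in.
  n : ℕ
  n = 4 + m

  -- Solvability modulo 2^r; the terms a ∷ V are those of least 2-adic valuation r - 1 - k.
  data Balanced : Pred (List A) 0ℓ where
    zeros : All (L 0) ys → Balanced ys
    level : ∀ k {a V H} → All (L (suc k)) (a ∷ V) → All (λ x → ¬ L k x) (a ∷ V) → All (L k) H →
            2 ∣ length (a ∷ V) → Balanced (a ∷ V ++ H)

  -- Solvability modulo p.
  Spread : Pred (List A) 0ℓ
  Spread ys = All (λ x → ¬ E x) ys ⊎ (∃[ x ] ∃[ y ] E x × E y × (x ∷ y ∷ []) ≼ ys)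

  Solvable : Pred (List A) 0ℓ
  Solvable ys = Balanced ys × Spread ys

  Chosen : Pred (List A) 0ℓ → Pred (List A) 0ℓ
  Chosen = Choice n

  -- The terms `x`, `y` and `hs` are kept, and `even-choice` supplies `t` further ones with an even
  -- number from `V`, so the level of `x` and `y` stays even.
  core-choice : ∀ k t {xs x y V} hs {H} → All (L (suc k)) xs →
    All (λ z → ¬ L k z) (x ∷ y ∷ V) → All (L k) (hs ++ H) → xs ↭ (x ∷ y ∷ V) ++ hs ++ H →
    t + length hs ≡ 2 + m → suc n ≤ length xs → 2 ∣ t ⊎ 1 ≤ length H →
    ∃[ ys ] x ∷ y ∷ hs ≼ ys × ys ≼ xs × length ys ≡ n × Balanced ys
  core-choice k t {xs} {x} {y} {V} hs {H} all ¬V aH p t≡ l par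
    with even-choice t V H (+-cancelˡ-≤ (2 + length hs) _ _ (begin
      2 + length hs + suc t           ≡⟨ +-suc (2 + length hs) t ⟩
      3 + (length hs + t)             ≡⟨ cong (λ i → 3 + i) (+-comm (length hs) t) ⟩
      3 + (t + length hs)             ≡⟨ cong (λ i → 3 + i) t≡ ⟩
      suc n                           ≤⟨ l ⟩
      length xs                       ≡⟨ length-↭-++ (x ∷ y ∷ V) p ⟩
      2 + (length V + length (hs ++ H)) ≡⟨ cong (λ j → 2 + (length V + j)) (length-++ hs) ⟩
      2 + (length V + (length hs + length H)) ≡⟨ cong (λ i → 2 + i) (x∙yz≈y∙xz (length V) (length hs) (length H)) ⟩
      2 + length hs + (length V + length H) ∎)) par
    where open ≤-Reasoning
  ... | V′ , H′ , s , u , ev , e = (x ∷ y ∷ V′) ++ hs ++ H′ ,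
        ≼-++⁺ (≼-++ˡ (x ∷ y ∷ []) {V′}) (≼-++ˡ hs {H′}) ,
        ≼-trans (≼-++⁺ s′ u′) (≼-reflexive p) ,
        cong (λ i → 2 + i) (begin
          length (V′ ++ hs ++ H′)                 ≡⟨ length-++ V′ ⟩
          length V′ + length (hs ++ H′)           ≡⟨ cong (λ i → length V′ + i) (length-++ hs) ⟩
          length V′ + (length hs + length H′)     ≡⟨ x∙yz≈xz∙y (length V′) (length hs) (length H′) ⟩
          length V′ + length H′ + length hs       ≡⟨ cong (_+ length hs) e ⟩
          t + length hs                           ≡⟨ t≡ ⟩
          2 + m                                   ∎) ,
        level k (All-≼ s′ (++⁻ˡ (x ∷ y ∷ V) (All-resp-↭ p all))) (All-≼ s′ ¬V) (All-≼ u′ aH) (2∣2+ ev)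
    where
    open ≡-Reasoning
    s′ = ≼-∷⁺ x (≼-∷⁺ y s)
    u′ = ≼-++⁺ (≼-refl {xs = hs}) u

  -- Descent through the valuations: an empty level is skipped, a single term is dropped at the cost
  -- of one unit of the bound, and two or more terms allow `core-choice` because `n` is even.
  balanced-choice : ∀ k xs → All (L k) xs → n + k ≤ length xs → Chosen Balanced xs
  balanced-choice zero xs all l =
    let ys , s , e = choose n xs (subst (_≤ length xs) (+-identityʳ n) l) in
    ys , s , e , zeros (All-≼ s all)
  balanced-choice (suc k) xs all l with split (L? k) xs
  ... | [] , H , p , _ , aH = Choice-≼ (≼-reflexive p) (balanced-choice k H aH
          (≤-trans (+-monoʳ-≤ n (n≤1+n k)) (≤-trans l (≤-reflexive (↭-length p)))))
  ... | x ∷ [] , H , p , _ , aH = Choice-≼ (≼-trans (≼-++ʳ (x ∷ [])) (≼-reflexive p)) (balanced-choice k H aH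
          (≤-pred (≤-trans (≤-reflexive (sym (+-suc n k))) (≤-trans l (≤-reflexive (↭-length p))))))
  ... | x ∷ y ∷ V , H , p , ¬V , aH =
          let ys , _ , s , e , b = core-choice k (2 + m) [] all ¬V aH p (+-identityʳ _)
                (≤-trans (≤-trans (s≤s (m≤m+n n k)) (≤-reflexive (sym (+-suc n k)))) l) (inj₁ (2∣2+ 2∣m))
          in ys , s , e , b

  -- A single term prime to p is dropped, which the one spare term allows; if there are two, both
  -- are kept and the rest is arbitrary.
  spread-choice : ∀ xs → suc n ≤ length xs → Chosen Spread xs
  spread-choice xs l with split E? xs
  ... | N , [] , p , aN , _ =
          let ys , s , e = choose n N (≤-trans (n≤1+n n) (≤-trans l (≤-reflexive
                (trans (length-↭-++ N p) (+-identityʳ _))))) in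
          ys , ≼-trans s (≼-trans (≼-++ˡ N) (≼-reflexive p)) , e , inj₁ (All-≼ s aN)
  ... | N , x ∷ [] , p , aN , _ =
          let ys , s , e = choose n N (≤-pred (≤-trans l (≤-reflexive
                (trans (length-↭-++ N p) (+-comm _ 1))))) in
          ys , ≼-trans s (≼-trans (≼-++ˡ N) (≼-reflexive p)) , e , inj₁ (All-≼ s aN)
  ... | N , x ∷ y ∷ Es , p , _ , ex ∷ ey ∷ _ =
          let ys , s , e = choose (2 + m) (Es ++ N) (≤-trans (n≤1+n (2 + m)) (+-cancelˡ-≤ 2 _ _ (≤-trans l (≤-reflexive
                (trans (↭-length p) (↭-length (↭-++-comm N (x ∷ y ∷ Es)))))))) in
          x ∷ y ∷ ys , ≼-trans (≼-∷⁺ x (≼-∷⁺ y s)) (≼-reflexive (↭-trans p (↭-++-comm N (x ∷ y ∷ Es)))) ,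
          cong (λ i → 2 + i) e , inj₂ (x , y , ex , ey , (ys , ↭-refl))

  -- Without the at most one term in `R`, every choice is solvable modulo p, so only balance has to
  -- be arranged.
  sparse-choice : ∀ k {xs} N R → All (L k) xs → xs ↭ N ++ R → All (λ x → ¬ E x) N → length R ≤ 1 →
                  suc (n + k) ≤ length xs → Chosen Solvable xs
  sparse-choice k {xs} N R all p aN r≤ l =
    let s = ≼-trans (≼-++ˡ N) (≼-reflexive p)
        us , t , e , b = balanced-choice k N (All-≼ s all) (+-cancelˡ-≤ 1 _ _
            (≤-trans l (≤-trans (≤-reflexive (trans (length-↭-++ N p) (+-comm (length N) _)))
               (+-monoˡ-≤ (length N) r≤))))
    in us , ≼-trans t s , e , b , inj₁ (All-≼ t aN)

  -- The descent of `balanced-choice`, with one more term in hand to deal with the condition modulo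
  -- p.
  solvable-choice : ∀ k xs → All (L k) xs → suc (n + k) ≤ length xs → Chosen Solvable xs
  solvable-choice zero xs all l =
    let ys , s , e , sp = spread-choice xs (subst (λ j → suc j ≤ length xs) (+-identityʳ n) l) in
    ys , s , e , zeros (All-≼ s all) , sp
  solvable-choice (suc k) xs all l with split (L? k) xs
  ... | [] , H , p , _ , aH = Choice-≼ (≼-reflexive p) (solvable-choice k H aH
          (≤-trans (s≤s (+-monoʳ-≤ n (n≤1+n k))) (≤-trans l (≤-reflexive (↭-length p)))))
  ... | x ∷ [] , H , p , _ , aH = Choice-≼ (≼-trans (≼-++ʳ (x ∷ [])) (≼-reflexive p)) (solvable-choice k H aH
          (≤-pred (≤-trans (≤-reflexive (cong suc (sym (+-suc n k)))) (≤-trans l (≤-reflexive (↭-length p))))))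
  ... | V@(x ∷ y ∷ V₀) , H , p , ¬V , aH with suc n ≤? length V
  -- The choice can be made inside the level: any `n` of its terms are balanced, since `n` is even.
  ...   | yes n<V with spread-choice V n<V
  ...     | v ∷ ys , s , e , sp = v ∷ ys , ≼-trans s (≼-trans (≼-++ˡ V) (≼-reflexive p)) , e ,
              subst Balanced (++-identityʳ (v ∷ ys)) (level k (All-≼ s aV) (All-≼ s ¬V) []
                (subst (2 ∣_) (sym e) (2∣2+ (2∣2+ 2∣m)))) , sp
    where aV = ++⁻ˡ V (All-resp-↭ p all)
  -- The level has between 2 and `n` terms. Two terms prime to p are kept wherever they lie, and the
  -- level is completed to an even number; if there is at most one, `sparse-choice` avoids it.
  solvable-choice (suc k) xs all l | V@(x ∷ y ∷ V₀) , H , p , ¬V , aH | no V≯n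
    with split E? V | split E? H
  ... | VN , v₁ ∷ v₂ ∷ VE , q , aVN , e₁ ∷ e₂ ∷ _ | _ =
          let q′ = ↭-trans q (↭-++-comm VN (v₁ ∷ v₂ ∷ VE))
              ys , c , s , e , b = core-choice k (2 + m) [] all (All-resp-↭ q′ ¬V) aH
                (↭-trans p (++⁺ʳ H q′)) (+-identityʳ _) n<xs (inj₁ (2∣2+ 2∣m))
          in ys , s , e , b , inj₂ (v₁ , v₂ , e₁ , e₂ , c)
    where n<xs = ≤-trans (s≤s (m≤m+n n (suc k))) l
  ... | VN , [] , q , aVN , _ | HN , [] , r , aHN , _ =
          sparse-choice (suc k) (VN ++ HN) [] all (++-interchange VN HN p q r) (All-++⁺ aVN aHN) z≤n l
  ... | VN , [] , q , aVN , _ | HN , h ∷ [] , r , aHN , _ =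
          sparse-choice (suc k) (VN ++ HN) (h ∷ []) all (++-interchange VN HN p q r) (All-++⁺ aVN aHN) (s≤s z≤n) l
  ... | VN , v ∷ [] , q , aVN , _ | HN , [] , r , aHN , _ =
          sparse-choice (suc k) (VN ++ HN) (v ∷ []) all (++-interchange VN HN p q r) (All-++⁺ aVN aHN) (s≤s z≤n) l
  ... | VN , [] , q , aVN , _ | HN , h₁ ∷ h₂ ∷ HE , r , aHN , e₁ ∷ e₂ ∷ _ =
          let r′ = ↭-trans r (↭-++-comm HN (h₁ ∷ h₂ ∷ HE))
              ys , c , s , e , b = core-choice k m (h₁ ∷ h₂ ∷ []) all ¬V (All-resp-↭ r′ aH)
                (↭-trans p (++⁺ˡ V r′)) (+-comm m 2) n<xs (inj₁ 2∣m)
          in ys , s , e , b , inj₂ (h₁ , h₂ , e₁ , e₂ , ≼-trans (≼-++ʳ (x ∷ y ∷ [])) c)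
    where n<xs = ≤-trans (s≤s (m≤m+n n (suc k))) l
  ... | [] , v ∷ [] , q , aVN , e₁ ∷ _ | HN , h ∷ HE , r , aHN , e₂ ∷ _ =
          contradiction (↭-length q) λ ()
  -- One term prime to p lies on the level, the other has higher valuation. With `v`, `u` and `h`
  -- kept, the odd number `1 + m` remains, so `even-choice` needs a second term in `H`: there is
  -- one, because `V` has at most `n` terms and `xs` at least `n + 2`.
  ... | u ∷ VN , v ∷ [] , q , aVN , e₁ ∷ _ | HN , h ∷ HE , r , aHN , e₂ ∷ _ =
          let q′ = ↭-trans q (↭-++-comm (u ∷ VN) (v ∷ []))
              r′ = ↭-trans r (↭-++-comm HN (h ∷ HE))
              ys , c , s , e , b = core-choice k (1 + m) (h ∷ []) all (All-resp-↭ q′ ¬V) (All-resp-↭ r′ aH)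
                (↭-trans p (++⁺ q′ r′)) (+-comm (1 + m) 1) n<xs (inj₂ (≤-pred (subst (2 ≤_) (↭-length r′) 2≤H)))
          in ys , s , e , b , inj₂ (v , h , e₁ , e₂ , ≼-trans (≼-∷⁺ v (≼-++ʳ (u ∷ []))) c)
    where
    n<xs = ≤-trans (s≤s (m≤m+n n (suc k))) l
    2≤H : 2 ≤ length H
    2≤H = +-cancelˡ-≤ n 2 (length H) (begin
      n + 2               ≡⟨ +-comm n 2 ⟩
      2 + n               ≤⟨ s≤s (s≤s (m≤m+n n k)) ⟩
      2 + (n + k)         ≡⟨ cong suc (+-suc n k) ⟨
      suc (n + suc k)     ≤⟨ l ⟩
      length xs           ≡⟨ length-↭-++ V p ⟩
      length V + length H ≤⟨ +-monoˡ-≤ (length H) (≤-pred (≰⇒> V≯n)) ⟩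
      n + length H        ∎)
      where open ≤-Reasoning

  -- The shape of a maximal unsolvable list without terms in E: every level from k + 1 down to 2
  -- has a single term, and level 1 has an odd number of terms.
  data Chain : ℕ → Pred (List A) 0ℓ where
    last : ∀ {xs V H} → xs ↭ V ++ H → All (L 1) V → All (λ x → ¬ L 0 x) V → All (L 0) H →
           ¬ 2 ∣ length V → length V + length H ≡ n → Chain 0 xs
    step : ∀ {k xs x ys} → xs ↭ x ∷ ys → L (2 + k) x → ¬ L (suc k) x → Chain k ys → Chain (suc k) xs

  -- The list is one term too short for `balanced-choice`. An empty level would make up for this,
  -- and two terms on a level would allow `core-choice`, so each level has exactly one. The last `n`
  -- terms can then fail only by parity.
  chain : ∀ k xs → All (L (suc k)) xs → length xs ≡ n + k → ¬ Chosen Balanced xs → Chain k xs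
  chain zero xs all l none with split (L? 0) xs
  ... | V , H , p , ¬V , aH with 2 ∣? length V
  ...   | no odd = last p (++⁻ˡ V (All-resp-↭ p all)) ¬V aH odd
                     (trans (sym (length-↭-++ V p)) (trans l (+-identityʳ n)))
  chain zero xs all l none | [] , H , p , ¬V , aH | yes ev =
    contradiction (xs , ≼-refl , trans l (+-identityʳ n) , zeros (All-resp-↭ (↭-sym p) aH)) none
  chain zero xs all l none | v ∷ V , H , p , ¬V , aH | yes ev =
    contradiction (v ∷ V ++ H , ≼-reflexive p , trans (sym (↭-length p)) (trans l (+-identityʳ n)) ,
      level 0 (++⁻ˡ (v ∷ V) (All-resp-↭ p all)) ¬V aH ev) none
  chain (suc k) xs all l none with split (L? (suc k)) xs
  ... | [] , H , p , _ , aH =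
          contradiction (Choice-≼ (≼-reflexive p) (balanced-choice (suc k) H aH
            (≤-reflexive (trans (sym l) (↭-length p))))) none
  ... | x ∷ [] , H , p , ¬x ∷ _ , aH with All-resp-↭ p all
  ...   | ax ∷ _ = step p ax ¬x (chain k H aH
            (suc-injective (trans (sym (↭-length p)) (trans l (+-suc n k))))
            (λ c → none (Choice-≼ (≼-trans (≼-++ʳ (x ∷ [])) (≼-reflexive p)) c)))
  chain (suc k) xs all l none | x ∷ y ∷ V , H , p , ¬V , aH =
    let ys , _ , s , e , b = core-choice (suc k) (2 + m) [] all ¬V aH p (+-identityʳ _)
          (≤-trans (s≤s (m≤m+n n k)) (≤-reflexive (sym (trans l (+-suc n k))))) (inj₁ (2∣2+ 2∣m))
    in contradiction (ys , s , e , b) none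

  -- Keeping x and y balances any choice from T, so each such choice contains exactly one term in
  -- E; a term of E in T could be both used and avoided.
  isolate : ∀ k {xs x y T} → xs ↭ x ∷ y ∷ T → L (suc k) x → L (suc k) y → ¬ L k x → ¬ L k y →
            All (L k) T → n ≤ length T → ¬ Chosen Solvable xs →
            ∃[ z ] ∃[ ys ] xs ↭ z ∷ ys × E z × All (λ w → ¬ E w) ys
  isolate k {xs} {x} {y} {T} p ax ay ¬x ¬y aT l none = go (split E? T)
    where
    absurd : ∀ {B} → B ≼ T → length B ≡ 2 + m → ¬ Spread (x ∷ y ∷ B)
    absurd s e sp = none (_ , ≼-trans (≼-∷⁺ x (≼-∷⁺ y s)) (≼-reflexive p) , cong (λ i → 2 + i) e ,
      level k (ax ∷ ay ∷ []) (¬x ∷ ¬y ∷ []) (All-≼ s aT) ∣-refl , sp)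
    Goal : Set
    Goal = ∃[ z ] ∃[ ys ] xs ↭ z ∷ ys × E z × All (λ w → ¬ E w) ys
    go : (∃[ N ] ∃[ R ] T ↭ N ++ R × All (λ w → ¬ E w) N × All E R) → Goal
    go (N , e₁ ∷ e₂ ∷ R , q , aN , E₁ ∷ E₂ ∷ _) =
      let B , s , e = choose m (R ++ N) (≤-trans (m≤n+m m 2) (+-cancelˡ-≤ 2 _ _
            (≤-trans l (≤-reflexive (trans (↭-length q) (↭-length (↭-++-comm N (e₁ ∷ e₂ ∷ R))))))))
      in contradiction (inj₂ (e₁ , e₂ , E₁ , E₂ , ≼-trans (≼-++ˡ (e₁ ∷ e₂ ∷ [])) (≼-++ʳ (x ∷ y ∷ []))))
           (absurd (≼-trans (≼-∷⁺ e₁ (≼-∷⁺ e₂ s)) (≼-reflexive (↭-trans q (↭-++-comm N (e₁ ∷ e₂ ∷ R))))) (cong (λ i → 2 + i) e))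
    go (N , e₁ ∷ [] , q , aN , E₁ ∷ _) = finish (E? x) (E? y)
      where
      2+m≤N : 2 + m ≤ length N
      2+m≤N = ≤-trans (n≤1+n (2 + m)) (≤-pred (≤-trans l (≤-reflexive
                (trans (↭-length q) (↭-length (↭-++-comm N (e₁ ∷ [])))))))
      B₁ : ∃[ B ] e₁ ∷ B ≼ T × length (e₁ ∷ B) ≡ 2 + m
      B₁ = let B , s , e = choose (1 + m) N (≤-trans (n≤1+n (1 + m)) 2+m≤N) in
           B , ≼-trans (≼-∷⁺ e₁ s) (≼-reflexive (↭-trans q (↭-++-comm N (e₁ ∷ [])))) , cong suc e
      finish : Dec (E x) → Dec (E y) → Goal
      finish (yes ex) _ = let B , s , e = B₁ in
        contradiction (inj₂ (x , e₁ , ex , E₁ , ≼-∷⁺ x (≼-∷ʳ y (≼-++ˡ (e₁ ∷ []))))) (absurd s e)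
      finish (no _) (yes ey) = let B , s , e = B₁ in
        contradiction (inj₂ (y , e₁ , ey , E₁ , ≼-∷ʳ x (≼-++ˡ (y ∷ e₁ ∷ [])))) (absurd s e)
      finish (no ¬ex) (no ¬ey) = let B , s , e = choose (2 + m) N 2+m≤N in
        contradiction (inj₁ (¬ex ∷ ¬ey ∷ All-≼ s aN))
          (absurd (≼-trans s (≼-trans (≼-++ˡ N) (≼-reflexive q))) e)
    go (N , [] , q , aN , _) = finish (E? x) (E? y)
      where
      aT′ : All (λ w → ¬ E w) T
      aT′ = All-resp-↭ (↭-sym q) (All-++⁺ aN [])
      any : ∃[ B ] B ≼ T × length B ≡ 2 + m
      any = choose (2 + m) T (≤-trans (m≤n+m (2 + m) 2) l)
      finish : Dec (E x) → Dec (E y) → Goal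
      finish (yes ex) (no ¬ey) = x , y ∷ T , p , ex , ¬ey ∷ aT′
      finish (no ¬ex) (yes ey) = y , x ∷ T , ↭-trans p (swap x y ↭-refl) , ey , ¬ex ∷ aT′
      finish (yes ex) (yes ey) = let B , s , e = any in
        contradiction (inj₂ (x , y , ex , ey , B , ↭-refl)) (absurd s e)
      finish (no ¬ex) (no ¬ey) = let B , s , e = any in
        contradiction (inj₁ (¬ex ∷ ¬ey ∷ All-≼ s aT′)) (absurd s e)

-- Weighted sums of residues

-- Invertibility of `c` modulo `q`, in the form that u c + d ≡ 0 is solvable for every d; this
-- avoids subtraction.
Solves : ℕ → ℕ → Set
Solves q c = ∀ d → ∃[ u ] q ∣ u * c + d

-- A solution `u` modulo `a` has quotient `e`; adding `a * u′` to it changes the quotient to u′ c +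
-- e, which can be made divisible by `b`. The factors may coincide, whence the case of powers.
Solves-* : ∀ {a b c} → Solves a c → Solves b c → Solves (a * b) c
Solves-* {a} {b} {c} solve-a solve-b d with solve-a d
... | u , divides e eq with solve-b e
...   | u′ , divides f eq′ = u + a * u′ , divides f (begin
  (u + a * u′) * c + d   ≡⟨ lemma₁ u a u′ c d ⟩
  u * c + d + a * (u′ * c) ≡⟨ cong (_+ a * (u′ * c)) eq ⟩
  e * a + a * (u′ * c)   ≡⟨ lemma₂ e a (u′ * c) ⟩
  a * (u′ * c + e)       ≡⟨ cong (a *_) eq′ ⟩
  a * (f * b)            ≡⟨ lemma₃ a f b ⟩
  f * (a * b)            ∎)
  where
  open ≡-Reasoning
  lemma₁ : ∀ u a u′ c d → (u + a * u′) * c + d ≡ u * c + d + a * (u′ * c)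
  lemma₁ = solve-∀
  lemma₂ : ∀ e a x → e * a + a * x ≡ a * (x + e)
  lemma₂ = solve-∀
  lemma₃ : ∀ a f b → a * (f * b) ≡ f * (a * b)
  lemma₃ = solve-∀

Solves-^ : ∀ {a c} k → Solves a c → Solves (a ^ k) c
Solves-^ zero solve-a d = 0 , 1∣ d
Solves-^ (suc k) solve-a = Solves-* solve-a (Solves-^ k solve-a)

prime∤⇒coprime : ∀ {p c} → Prime p → ¬ p ∣ c → ℕ.Coprime c p
prime∤⇒coprime pr p∤c (i∣c , i∣p) with prime⇒irreducible pr i∣p
... | inj₁ i≡1 = i≡1
... | inj₂ refl = contradiction i∣c p∤c

prime∤⇒Solves : ∀ {q c} → Prime q → ¬ q ∣ c → Solves q c
prime∤⇒Solves {q@(suc q-1)} {c} pr q∤c d with ℕ.coprime-Bézout (ℕ.sym (prime∤⇒coprime pr q∤c))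
-- Here y c ≡ 1, so the solution is -d y, and `q-1` stands for -1. In the other case y c ≡ -1 and d
-- y serves directly.
... | Bézout.-+ x y eq = q-1 * (d * y) , divides (d * (x * q-1 + 1)) (begin
  q-1 * (d * y) * c + d        ≡⟨ lemma₁ q-1 d y c ⟩
  q-1 * d * (y * c) + d        ≡⟨ cong (λ z → q-1 * d * z + d) (sym eq) ⟩
  q-1 * d * (1 + x * suc q-1) + d ≡⟨ lemma₂ q-1 d x ⟩
  d * (x * q-1 + 1) * suc q-1  ∎)
  where
  open ≡-Reasoning
  lemma₁ : ∀ q d y c → q * (d * y) * c + d ≡ q * d * (y * c) + d
  lemma₁ = solve-∀
  lemma₂ : ∀ q d x → q * d * (1 + x * suc q) + d ≡ d * (x * q + 1) * suc q
  lemma₂ = solve-∀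
... | Bézout.+- x y eq = d * y , divides (d * x) (begin
  d * y * c + d    ≡⟨ lemma d y c ⟩
  d * (1 + y * c)  ≡⟨ cong (d *_) eq ⟩
  d * (x * q)      ≡⟨ *-assoc d x q ⟨
  d * x * q        ∎)
  where
  open ≡-Reasoning
  lemma : ∀ d y c → d * y * c + d ≡ d * (1 + y * c)
  lemma = solve-∀

Odd : Pred ℕ 0ℓ
Odd w = ¬ 2 ∣ w

2∤1 : Odd 1
2∤1 2∣1 = contradiction (∣1⇒≡1 2∣1) λ ()

odd+odd : ∀ {a b} → Odd a → Odd b → 2 ∣ a + b
odd+odd {zero} oa ob = contradiction (2 ∣0) oa
odd+odd {suc zero} oa ob = 2∤⇒2∣suc ob
odd+odd {suc (suc a)} oa ob = ∣m∣n⇒∣m+n (∣-refl {2}) (odd+odd (λ 2∣a → oa (∣m∣n⇒∣m+n (∣-refl {2}) 2∣a)) ob)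

-- The sum is formed in ℕ from representatives, so that the same sum can be reduced modulo powers of
-- 2, p or n.
data WSum {n} (P : Pred ℕ 0ℓ) : List (Fin n) → ℕ → Set where
  []  : WSum P [] 0
  _∷_ : ∀ {w x xs s} → P w → WSum P xs s → WSum P (x ∷ xs) (w * toℕ x + s)

private variable
  n s t : ℕ
  P Q R : Pred ℕ 0ℓ

infix 4 _∣ᶠ_
_∣ᶠ_ : ℕ → Fin n → Set
d ∣ᶠ x = d ∣ toℕ x

WSum-resp-↭ : {xs ys : List (Fin n)} → xs ↭ ys → WSum P xs s → WSum P ys s
WSum-resp-↭ refl ws = ws
WSum-resp-↭ (prep x p) (w ∷ ws) = w ∷ WSum-resp-↭ p ws
WSum-resp-↭ (swap x y p) (_∷_ {w = w} pw (_∷_ {w = v} {s = s} pv ws)) =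
  subst (WSum _ _) (x∙yz≈y∙xz (v * toℕ y) (w * toℕ x) s) (pv ∷ pw ∷ WSum-resp-↭ p ws)
WSum-resp-↭ (↭-step p q) ws = WSum-resp-↭ q (WSum-resp-↭ p ws)

WSum-map : {xs : List (Fin n)} → (∀ {w} → P w → Q w) → WSum P xs s → WSum Q xs s
WSum-map f [] = []
WSum-map f (w ∷ ws) = f w ∷ WSum-map f ws

WSum-combine : ∀ {xs : List (Fin n)} a b → (∀ {v w} → P v → Q w → R (a * v + b * w)) →
               WSum P xs s → WSum Q xs t → WSum R xs (a * s + b * t)
WSum-combine {R = R} a b f [] [] = subst (WSum R []) (sym (cong₂ _+_ (*-zeroʳ a) (*-zeroʳ b))) []
WSum-combine {R = R} a b f (_∷_ {w = v} {x} {s = s} pv vs) (_∷_ {w = w} {s = t} pw ws) =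
  subst (WSum R _) (lemma a b v w (toℕ x) s t) (f pv pw ∷ WSum-combine a b f vs ws)
  where
  lemma : ∀ a b v w x s t → (a * v + b * w) * x + (a * s + b * t) ≡ a * (v * x + s) + b * (w * x + t)
  lemma = solve-∀

unweighted : P 1 → (xs : List (Fin n)) → ∃[ s ] WSum P xs s
unweighted p1 [] = 0 , []
unweighted p1 (x ∷ xs) = let s , ws = unweighted p1 xs in _ , p1 ∷ ws

∣-WSum : ∀ {d} {xs : List (Fin n)} → All (d ∣ᶠ_) xs → WSum P xs s → d ∣ s
∣-WSum {d = d} [] [] = d ∣0
∣-WSum (dx ∷ all) (_∷_ {w = w} _ ws) = ∣m∣n⇒∣m+n (∣n⇒∣m*n w dx) (∣-WSum all ws)

module _ (q : ℕ) .{{_ : NonZero q}} where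

  private
    odd-multiple : ∀ {w z} → Odd w → q ∣ z → ¬ 2 * q ∣ z → ¬ 2 * q ∣ w * z
    odd-multiple {w} {z} ow (divides c refl) ¬z d
      with euclidsLemma w c prime[2] (*-cancelʳ-∣ q (subst (2 * q ∣_) (sym (*-assoc w c q)) d))
    ... | inj₁ 2∣w = ow 2∣w
    ... | inj₂ 2∣c = ¬z (*-monoˡ-∣ q 2∣c)

    odd-multiples-+ : ∀ {y z} → q ∣ y → q ∣ z → ¬ 2 * q ∣ y → ¬ 2 * q ∣ z → 2 * q ∣ y + z
    odd-multiples-+ (divides a refl) (divides b refl) ¬y ¬z =
      subst (2 * q ∣_) (*-distribʳ-+ q a b)
        (*-monoˡ-∣ q (odd+odd {a} {b} (λ d → ¬y (*-monoˡ-∣ q d)) (λ d → ¬z (*-monoˡ-∣ q d))))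

  -- An odd multiple of `q` with an odd weight is congruent to `q` modulo `2 * q`, so the whole sum
  -- is congruent to `length V` times `q`.
  WSum-parity : {V H : List (Fin n)} → All (q ∣ᶠ_) V → All (λ x → ¬ 2 * q ∣ᶠ x) V → All (2 * q ∣ᶠ_) H →
                WSum Odd (V ++ H) s → (2 ∣ length V → 2 * q ∣ s) × (2 * q ∣ s → 2 ∣ length V) × q ∣ s
  WSum-parity [] [] aH ws = let d = ∣-WSum aH ws in (λ _ → d) , (λ _ → 2 ∣0) , m*n∣⇒n∣ 2 q d
  WSum-parity {s = s} {V = x ∷ V} (qx ∷ aV) (¬x ∷ ¬V) aH (_∷_ {w = w} {s = s′} ow ws)
    with WSum-parity aV ¬V aH ws
  ... | to , from , q∣s = even , odd , ∣m∣n⇒∣m+n q∣wx q∣s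
    where
    q∣wx = ∣n⇒∣m*n w qx
    ¬wx = odd-multiple ow qx ¬x
    even : 2 ∣ suc (length V) → 2 * q ∣ w * toℕ x + s′
    even ev = odd-multiples-+ q∣wx q∣s ¬wx λ d →
      2∤1 (∣m+n∣m⇒∣n (subst (2 ∣_) (+-comm 1 (length V)) ev) (from d))
    odd : 2 * q ∣ w * toℕ x + s′ → 2 ∣ suc (length V)
    odd d with 2 ∣? length V
    ... | yes ev = contradiction (∣m+n∣m⇒∣n (subst (2 * q ∣_) (+-comm _ s′) d) (to ev)) ¬wx
    ... | no o = 2∤⇒2∣suc o

  -- After division by `q` the equation is u c + d ≡ 0 with c and d odd: c odd makes it solvable
  -- modulo powers of 2, and d odd forces u to be odd.
  cancelling-weight : ∀ r {a t} → q ∣ a → q ∣ t → ¬ 2 * q ∣ a → ¬ 2 * q ∣ t → ∃[ u ] Odd u × 2 ^ r ∣ u * a + t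
  cancelling-weight r (divides c refl) (divides d refl) ¬a ¬t = u , odd-u , subst (2 ^ r ∣_) (lemma u c d q)
    (∣m⇒∣m*n q (m*n∣⇒n∣ 2 (2 ^ r) e))
    where
    -- Solving modulo 2^(r + 1) makes u odd even when r = 0.
    solution : ∃[ u ] 2 * 2 ^ r ∣ u * c + d
    solution = Solves-^ (suc r) (prime∤⇒Solves prime[2] (λ 2∣c → ¬a (*-monoˡ-∣ q 2∣c))) d
    u = proj₁ solution
    e : 2 * 2 ^ r ∣ u * c + d
    e = proj₂ solution
    odd-u : Odd u
    odd-u 2∣u = ¬t (*-monoˡ-∣ q (∣m+n∣m⇒∣n {m = u * c} (m*n∣⇒m∣ 2 (2 ^ r) e) (∣m⇒∣m*n c 2∣u)))
    lemma : ∀ u c d q → (u * c + d) * q ≡ u * (c * q) + d * q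
    lemma = solve-∀

  -- All terms except `a` get weight 1. As `V` has odd length, their sum is an odd multiple of `q`,
  -- just like `a`, and the weight of `a` cancels it.
  WSum-balance : ∀ {a} {V H : List (Fin n)} r → All (q ∣ᶠ_) (a ∷ V) → All (λ x → ¬ 2 * q ∣ᶠ x) (a ∷ V) →
    All (2 * q ∣ᶠ_) H → 2 ∣ length (a ∷ V) → ∃[ s ] WSum Odd (a ∷ V ++ H) s × 2 ^ r ∣ s
  WSum-balance {V = V} {H} r (qa ∷ aV) (¬a ∷ ¬V) aH ev =
    let t , ws = unweighted {P = Odd} 2∤1 (V ++ H)
        _ , odd , q∣t = WSum-parity aV ¬V aH ws
        u , odd-u , e = cancelling-weight r qa q∣t ¬a λ d →
          2∤1 (∣m+n∣m⇒∣n (subst (2 ∣_) (+-comm 1 (length V)) ev) (odd d))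
    in _ , odd-u ∷ ws , e

-- Weights prime to an odd prime.

prime∤1 : ∀ {p} → Prime p → ¬ p ∣ 1
prime∤1 pr p∣1 with refl ← ∣1⇒≡1 p∣1 = ¬prime[1] pr

prime∣prime⇒≡ : ∀ {p q} → Prime p → Prime q → p ∣ q → p ≡ q
prime∣prime⇒≡ pr pr′ p∣q with prime⇒irreducible pr′ p∣q
... | inj₁ refl = contradiction pr ¬prime[1]
... | inj₂ p≡q = p≡q

prime∣^⇒∣ : ∀ {p} q r → Prime p → p ∣ q ^ r → p ∣ q
prime∣^⇒∣ q zero pr p∣1 = contradiction p∣1 (prime∤1 pr)
prime∣^⇒∣ q (suc r) pr d = [ (λ p∣q → p∣q) , prime∣^⇒∣ q r pr ]′ (euclidsLemma q (q ^ r) pr d)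

module _ {p} (pr : Prime p) (2∤p : ¬ 2 ∣ p) where

  odd-prime∤2 : ¬ p ∣ 2
  odd-prime∤2 p∣2 with refl ← prime∣prime⇒≡ pr prime[2] p∣2 = 2∤p ∣-refl

  -- One of the weights w = 1 and w = 2 makes w y + s prime to p.
  cancelling-weights : ∀ {x y} s → ¬ p ∣ x → ¬ p ∣ y →
                       ∃[ u ] ∃[ w ] ¬ p ∣ u × ¬ p ∣ w × p ∣ u * x + (w * y + s)
  cancelling-weights {x} {y} s p∤x p∤y with p ∣? 1 * y + s
  ... | no p∤ = let u , d = prime∤⇒Solves pr p∤x (1 * y + s) in
    u , 1 , (λ p∣u → p∤ (∣m+n∣m⇒∣n d (∣m⇒∣m*n x p∣u))) , prime∤1 pr , d
  ... | yes p∣ = let u , d = prime∤⇒Solves pr p∤x (2 * y + s) in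
    u , 2 , (λ p∣u → p∤ (∣m+n∣m⇒∣n d (∣m⇒∣m*n x p∣u))) , odd-prime∤2 , d
    where
    lemma : ∀ y s → 2 * y + s ≡ 1 * y + s + y
    lemma = solve-∀
    p∤ : ¬ p ∣ 2 * y + s
    p∤ d = p∤y (∣m+n∣m⇒∣n (subst (p ∣_) (lemma y s) d) p∣)

  WSum-spread : {x y : Fin n} {xs : List (Fin n)} → ¬ p ∣ᶠ x → ¬ p ∣ᶠ y →
    (x ∷ y ∷ []) ≼ xs → ∃[ s ] WSum (λ w → ¬ p ∣ w) xs s × p ∣ s
  WSum-spread p∤x p∤y (R , perm) =
    let s , ws = unweighted {P = λ w → ¬ p ∣ w} (prime∤1 pr) R
        u , w , p∤u , p∤w , d = cancelling-weights s p∤x p∤y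
    in _ , WSum-resp-↭ (↭-sym perm) (p∤u ∷ p∤w ∷ ws) , d

-- Sublists, permutations and vectors.

private variable
  l l′ : ℕ

⊆-resp-↭ : ∀ {us xs ys : List A} → us ⊆ xs → xs ↭ ys → ∃[ vs ] us ↭ vs × vs ⊆ ys
⊆-resp-↭ s refl = _ , ↭-refl , s
⊆-resp-↭ (x ∷ʳ s) (prep x p) = let vs , q , t = ⊆-resp-↭ s p in vs , q , x ∷ʳ t
⊆-resp-↭ (refl ∷ s) (prep x p) = let vs , q , t = ⊆-resp-↭ s p in x ∷ vs , prep x q , refl ∷ t
⊆-resp-↭ (x ∷ʳ (y ∷ʳ s)) (swap x y p) = let vs , q , t = ⊆-resp-↭ s p in vs , q , y ∷ʳ (x ∷ʳ t)
⊆-resp-↭ (x ∷ʳ (refl ∷ s)) (swap x y p) = let vs , q , t = ⊆-resp-↭ s p in y ∷ vs , prep y q , refl ∷ (x ∷ʳ t)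
⊆-resp-↭ (refl ∷ (y ∷ʳ s)) (swap x y p) = let vs , q , t = ⊆-resp-↭ s p in x ∷ vs , prep x q , y ∷ʳ (refl ∷ t)
⊆-resp-↭ (refl ∷ (refl ∷ s)) (swap x y p) =
  let vs , q , t = ⊆-resp-↭ s p in y ∷ x ∷ vs , swap x y q , refl ∷ (refl ∷ t)
⊆-resp-↭ s (↭-step p q) =
  let vs , r , t = ⊆-resp-↭ s p
      ws , r′ , t′ = ⊆-resp-↭ t q
  in ws , ↭-trans r r′ , t′

-- An index set cuts out a sublist in the original order, so a multiset choice has to be rearranged
-- before it is realised.
≼⇒⊆ : ∀ {xs ys : List A} → ys ≼ xs → ∃[ vs ] ys ↭ vs × vs ⊆ xs
≼⇒⊆ {ys = ys} (zs , p) = ⊆-resp-↭ (⊆-++⁺ʳ zs (⊆-refl {x = ys})) (↭-sym p)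

tabulate-punchIn : ∀ (f : Fin (suc l) → A) j → toList (tabulate f) ↭ f j ∷ toList (tabulate (f ∘ punchIn j))
tabulate-punchIn f zero = ↭-refl
tabulate-punchIn {l = suc l} f (suc j) = ↭-trans (prep (f zero) (tabulate-punchIn (f ∘ suc) j)) (swap _ _ ↭-refl)

tabulate-permute : ∀ (σ : Permutation l l′) (f : Fin l′ → A) →
                   toList (tabulate (f ∘ (σ ⟨$⟩ʳ_))) ↭ toList (tabulate f)
tabulate-permute {zero} {zero} σ f = ↭-refl
tabulate-permute {zero} {suc l′} σ f = contradiction (↔⇒≡ σ) λ ()
tabulate-permute {suc l} {zero} σ f = contradiction (↔⇒≡ σ) λ ()
tabulate-permute {suc l} {suc l′} σ f = ↭-trans (prep _ (subst (λ v → toList v ↭ toList (tabulate (f ∘ punchIn (σ ⟨$⟩ʳ zero)))) tab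
    (tabulate-permute (Perm.remove zero σ) (f ∘ punchIn (σ ⟨$⟩ʳ zero)))))
  (↭-sym (tabulate-punchIn f (σ ⟨$⟩ʳ zero)))
  where tab = tabulate-cong λ i → cong f (sym (Perm.punchIn-permute σ zero i))

lookup-toList : ∀ (xs : Vec A l) i → List.lookup (toList xs) i ≡ lookup xs (Fin.cast (length-toList xs) i)
lookup-toList (x ∷ xs) zero = refl
lookup-toList (x ∷ xs) (suc i) = lookup-toList xs i

lookup-cast : ∀ (xs : Vec A l) i → List.lookup (toList xs) (Fin.cast (sym (length-toList xs)) i) ≡ lookup xs i
lookup-cast (x ∷ xs) zero = refl
lookup-cast (x ∷ xs) (suc i) = lookup-cast xs i

↭⇒permutation : ∀ {xs : Vec A l} {ys : Vec A l′} → toList xs ↭ toList ys →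
                Σ[ σ ∈ Permutation l l′ ] (∀ i → lookup ys (σ ⟨$⟩ʳ i) ≡ lookup xs i)
↭⇒permutation {A = A} {xs = xs} {ys} p =
  cast-id (sym (length-toList xs)) ∘ₚ onIndices (↭⇒↭ₛ p) ∘ₚ cast-id (length-toList ys) ,
  λ i → trans (sym (lookup-toList ys _))
    (trans (sym (↭ₛ.onIndices-lookup (setoid A) (↭⇒↭ₛ p) (Fin.cast (sym (length-toList xs)) i)))
      (lookup-cast xs i))

separate : ∀ {P : Pred A 0ℓ} (I : Subset l) (xs : Vec A l) → (∀ i → i ∈ₛ I ⇔ P (lookup xs i)) →
  ∃[ ys ] ∃[ zs ] toList xs ↭ ys ++ zs × length ys ≡ ∥ I ∥ × All P ys × All (λ x → ¬ P x) zs
separate [] [] _ = [] , [] , ↭-refl , refl , [] , []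
separate (b ∷ I) (x ∷ xs) iff with separate I xs (λ i → mk⇔
   (λ i∈I → Equivalence.to (iff (suc i)) (there i∈I))
   (λ Px → case (Equivalence.from (iff (suc i)) Px) of λ { (there i∈I) → i∈I }))
... | ys , zs , p , e , aP , a¬P with b
...   | inside = x ∷ ys , zs , prep x p , cong suc e , Equivalence.to (iff zero) here ∷ aP , a¬P
...   | outside = ys , x ∷ zs , ↭-trans (prep x p) (↭-sym (shift x ys zs)) , e , aP ,
          (λ Px → case (Equivalence.from (iff zero) Px) of λ ()) ∷ a¬P

-- Sequences as vectors over ℤ/n

module _ {n : ℕ} .{{_ : NonZero n}} where

  toℕ-mod : ∀ m → toℕ (m mod n) ≡ m % n
  toℕ-mod m = toℕ-fromℕ< (m%n<n m n)

  toℕ-% : ∀ (x : ℤ/ n) → toℕ x % n ≡ toℕ x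
  toℕ-% x = m<n⇒m%n≡m (toℕ<n x)

  toℕ-ι : ∀ z → toℕ (ι {n} z) ≡ z %ℕ n
  toℕ-ι z = trans (toℕ-mod (z %ℕ n)) (m<n⇒m%n≡m (ℤ.n%ℕd<d z n))

  toℕ-0 : toℕ (ι {n} 0ℤ) ≡ 0
  toℕ-0 = trans (toℕ-ι 0ℤ) (n∣m⇒m%n≡0 0 n (n ∣0))

  ι-toℕ : ∀ (x : ℤ/ n) → ι (+ toℕ x) ≡ x
  ι-toℕ x = toℕ-injective (trans (toℕ-ι (+ toℕ x)) (toℕ-% x))

  ι-∣⁺ : ∀ {d} z → d ∣ n → d ∣ ℤ.∣ z ∣ → d ∣ᶠ ι {n} z
  ι-∣⁺ {d} z d∣n d∣z = subst (d ∣_) (sym (toℕ-ι z)) (ℤ.∣⇒∣ᵤ (ℤ.∣m+n∣n⇒∣m {+ d} {+ (z %ℕ n)}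
    (subst (+ d ℤ.∣_) (ℤ.a≡a%ℕn+[a/ℕn]*n z n) (ℤ.∣ᵤ⇒∣ d∣z)) (ℤ.∣n⇒∣m*n {+ d} (z ℤ./ℕ n) {+ n} (ℤ.∣ᵤ⇒∣ d∣n))))

  ι-∣⁻ : ∀ {d} z → d ∣ n → d ∣ᶠ ι {n} z → d ∣ ℤ.∣ z ∣
  ι-∣⁻ {d} z d∣n d∣x = ℤ.∣⇒∣ᵤ (subst (+ d ℤ.∣_) (sym (ℤ.a≡a%ℕn+[a/ℕn]*n z n))
    (ℤ.∣m∣n⇒∣m+n {+ d} {+ (z %ℕ n)} (ℤ.∣ᵤ⇒∣ (subst (d ∣_) (toℕ-ι z) d∣x)) (ℤ.∣n⇒∣m*n {+ d} (z ℤ./ℕ n) {+ n} (ℤ.∣ᵤ⇒∣ d∣n))))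

  -- Coprimality to `n`, phrased through prime factors so that Euclid's lemma applies to products.
  Admissible : Pred ℕ 0ℓ
  Admissible w = ∀ {q} → Prime q → q ∣ n → ¬ q ∣ w

  *ₙ-comm : ∀ (x y : ℤ/ n) → x *ₙ y ≡ y *ₙ x
  *ₙ-comm x y = cong (_mod n) (*-comm (toℕ x) (toℕ y))

  *ₙ-assoc : ∀ (x y z : ℤ/ n) → (x *ₙ y) *ₙ z ≡ x *ₙ (y *ₙ z)
  *ₙ-assoc x y z = toℕ-injective (begin
    toℕ ((x *ₙ y) *ₙ z)              ≡⟨ toℕ-mod _ ⟩
    toℕ (x *ₙ y) * toℕ z % n         ≡⟨ cong₂ (λ a b → a * b % n) (toℕ-mod _) (sym (toℕ-% z)) ⟩
    (toℕ x * toℕ y % n) * (toℕ z % n) % n ≡⟨ %-distribˡ-* (toℕ x * toℕ y) (toℕ z) n ⟨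
    toℕ x * toℕ y * toℕ z % n        ≡⟨ cong (_% n) (*-assoc (toℕ x) (toℕ y) (toℕ z)) ⟩
    toℕ x * (toℕ y * toℕ z) % n      ≡⟨ %-distribˡ-* (toℕ x) (toℕ y * toℕ z) n ⟩
    (toℕ x % n) * (toℕ y * toℕ z % n) % n ≡⟨ cong₂ (λ a b → a * b % n) (toℕ-% x) (sym (toℕ-mod _)) ⟩
    toℕ x * toℕ (y *ₙ z) % n         ≡⟨ toℕ-mod _ ⟨
    toℕ (x *ₙ (y *ₙ z))              ∎)
    where open ≡-Reasoning

  *ₙ-identityˡ : ∀ (x : ℤ/ n) → ι 1ℤ *ₙ x ≡ x
  *ₙ-identityˡ x = toℕ-injective (begin
    toℕ (ι 1ℤ *ₙ x)          ≡⟨ toℕ-mod _ ⟩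
    toℕ (ι {n} 1ℤ) * toℕ x % n   ≡⟨ cong₂ (λ a b → a * b % n) (toℕ-ι 1ℤ) (sym (toℕ-% x)) ⟩
    (1 % n) * (toℕ x % n) % n ≡⟨ %-distribˡ-* 1 (toℕ x) n ⟨
    1 * toℕ x % n            ≡⟨ cong (_% n) (*-identityˡ (toℕ x)) ⟩
    toℕ x % n                ≡⟨ toℕ-% x ⟩
    toℕ x                    ∎)
    where open ≡-Reasoning

  U-1 : U n (ι 1ℤ)
  U-1 = ι 1ℤ , *ₙ-identityˡ (ι 1ℤ) , *ₙ-identityˡ (ι 1ℤ)

  Solves⇒U : ∀ {w} → Solves n w → U n (w mod n)
  Solves⇒U {w} solve with solve (n ∸ 1)
  ... | u , divides k eq = u mod n , inverse , trans (*ₙ-comm (w mod n) (u mod n)) inverse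
    where
    open ≡-Reasoning
    uw : u * w + n ≡ 1 + k * n
    uw = begin
      u * w + n               ≡⟨ cong (λ j → u * w + j) (m∸n+n≡m (>-nonZero⁻¹ n)) ⟨
      u * w + (n ∸ 1 + 1)     ≡⟨ +-assoc (u * w) (n ∸ 1) 1 ⟨
      u * w + (n ∸ 1) + 1     ≡⟨ cong (_+ 1) eq ⟩
      k * n + 1               ≡⟨ +-comm (k * n) 1 ⟩
      1 + k * n               ∎
    inverse : (u mod n) *ₙ (w mod n) ≡ ι 1ℤ
    inverse = toℕ-injective (begin
      toℕ ((u mod n) *ₙ (w mod n))       ≡⟨ toℕ-mod _ ⟩
      toℕ (u mod n) * toℕ (w mod n) % n  ≡⟨ cong₂ (λ a b → a * b % n) (toℕ-mod u) (toℕ-mod w) ⟩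
      (u % n) * (w % n) % n              ≡⟨ %-distribˡ-* u w n ⟨
      u * w % n                          ≡⟨ [m+n]%n≡m%n (u * w) n ⟨
      (u * w + n) % n                    ≡⟨ cong (_% n) uw ⟩
      (1 + k * n) % n                    ≡⟨ [m+kn]%n≡m%n 1 k n ⟩
      1 % n                              ≡⟨ toℕ-ι 1ℤ ⟨
      toℕ (ι {n} 1ℤ)                     ∎)

  U⇒Admissible : ∀ {x} → U n x → Admissible (toℕ x)
  U⇒Admissible {x} (y , yx≡1 , _) {q} pr q∣n q∣x = prime∤1 pr (∣n∣m%n⇒∣m q∣n
    (subst (q ∣_) (trans (sym (toℕ-mod _)) (trans (cong toℕ yx≡1) (toℕ-ι 1ℤ)))
      (%-presˡ-∣ (∣n⇒∣m*n (toℕ y) q∣x) q∣n)))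

  Admissible-* : ∀ {x y : ℤ/ n} → Admissible (toℕ x) → Admissible (toℕ y) → Admissible (toℕ (x *ₙ y))
  Admissible-* {x} {y} ax ay {q} pr q∣n d =
    [ ax pr q∣n , ay pr q∣n ]′ (euclidsLemma (toℕ x) (toℕ y) pr
      (∣n∣m%n⇒∣m q∣n (subst (q ∣_) (toℕ-mod _) d)))

  toℕ-+ₙ : ∀ {x y : ℤ/ n} a b → toℕ x ≡ a % n → toℕ y ≡ b % n → toℕ (x +ₙ y) ≡ (a + b) % n
  toℕ-+ₙ a b ea eb = trans (toℕ-mod _) (trans (cong₂ (λ i j → (i + j) % n) ea eb) (sym (%-distribˡ-+ a b n)))

  -- Together with its converse `extract`, the bridge between sums in ℕ over sublists and weighted
  -- sums over index sets.
  realise : ∀ {P : Pred ℕ 0ℓ} {xs : Vec (ℤ/ n) l} {ys s} → ys ⊆ toList xs → WSum P ys s →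
            Σ[ I ∈ Subset l ] Σ[ a ∈ (Fin l → ℤ/ n) ] ∥ I ∥ ≡ length ys ×
            (∀ i → i ∈ₛ I → ∃[ w ] P w × a i ≡ w mod n) × toℕ (weightedSum I a xs) ≡ s % n
  realise {xs = []} [] [] = [] , (λ ()) , refl , (λ _ ()) , toℕ-ι 0ℤ
  realise {xs = x ∷ xs} (_ ∷ʳ sub) ws with realise sub ws
  -- Outside the index set any weight will do; `x` is an element at hand.
  ... | I , a , c , Pa , e = outside ∷ I , (λ { zero → x ; (suc i) → a i }) , c ,
        (λ { (suc i) (there i∈I) → Pa i i∈I }) , toℕ-+ₙ 0 _ (toℕ-ι 0ℤ) e
  realise {xs = x ∷ xs} (refl ∷ sub) (_∷_ {w = w} {s = s} pw ws) with realise sub ws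
  ... | I , a , c , Pa , e = inside ∷ I , (λ { zero → w mod n ; (suc i) → a i }) , cong suc c ,
        (λ { zero _ → w , pw , refl ; (suc i) (there i∈I) → Pa i i∈I }) , toℕ-+ₙ (w * toℕ x) s (begin
          toℕ ((w mod n) *ₙ x)        ≡⟨ toℕ-mod _ ⟩
          toℕ (w mod n) * toℕ x % n   ≡⟨ cong₂ (λ i j → i * j % n) (toℕ-mod w) (sym (toℕ-% x)) ⟩
          (w % n) * (toℕ x % n) % n   ≡⟨ %-distribˡ-* w (toℕ x) n ⟨
          w * toℕ x % n               ∎) e
    where open ≡-Reasoning

  extract : ∀ {P : Pred ℕ 0ℓ} (I : Subset l) (a : Fin l → ℤ/ n) (xs : Vec (ℤ/ n) l) →
            (∀ i → i ∈ₛ I → P (toℕ (a i))) →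
            ∃[ ys ] ∃[ s ] ys ⊆ toList xs × length ys ≡ ∥ I ∥ × WSum P ys s × toℕ (weightedSum I a xs) ≡ s % n
  extract [] a [] Pa = [] , 0 , [] , refl , [] , toℕ-ι 0ℤ
  extract (b ∷ I) a (x ∷ xs) Pa with extract I (a ∘ suc) xs (λ i i∈I → Pa (suc i) (there i∈I))
  ... | ys , s , sub , c , ws , e with b
  ...   | inside = x ∷ ys , _ , refl ∷ sub , cong suc c , Pa zero here ∷ ws , toℕ-+ₙ (toℕ (a zero) * toℕ x) s (toℕ-mod _) e
  ...   | outside = ys , s , x ∷ʳ sub , c , ws , toℕ-+ₙ 0 s (toℕ-ι 0ℤ) e

-- Standard sequences

truncate-⊆ : ∀ {A : Set} {k l} (k≤l : k ≤ l) (xs : Vec A l) → toList (truncate k≤l xs) ⊆ toList xs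
truncate-⊆ z≤n xs = minimum (toList xs)
truncate-⊆ (s≤s k≤l) (x ∷ xs) = refl ∷ truncate-⊆ k≤l xs

toList-replicate : ∀ {A : Set} k (x : A) → toList (replicate k x) ≡ List.replicate k x
toList-replicate zero x = refl
toList-replicate (suc k) x = cong (x ∷_) (toList-replicate k x)

module _ {n : ℕ} .{{_ : NonZero n}} where

  HasSolution : List (ℤ/ n) → Set
  HasSolution xs = ∃[ ys ] ∃[ s ] ys ⊆ xs × length ys ≡ n × WSum (Admissible {n}) ys s × n ∣ s

  zeroSum⇒HasSolution : ∀ {l} {xs : Vec (ℤ/ n) l} I (a : Fin l → ℤ/ n) → ∥ I ∥ ≡ n →
    (∀ i → i ∈ₛ I → Admissible {n} (toℕ (a i))) → weightedSum I a xs ≡ ι 0ℤ → HasSolution (toList xs)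
  zeroSum⇒HasSolution {xs = xs} I a ∣I∣ adm sum≡0 =
    let ys , s , sub , c , ws , e = extract I a xs adm in
    ys , s , sub , trans c ∣I∣ , ws ,
    m%n≡0⇒n∣m s n (trans (sym e) (trans (cong toℕ sum≡0) toℕ-0))

  HasSolution-⊆ : ∀ {xs ys} → xs ⊆ ys → HasSolution xs → HasSolution ys
  HasSolution-⊆ p (us , s , sub , rest) = us , s , ⊆-trans sub p , rest

  HasSolution-↭ : ∀ {xs ys} → xs ↭ ys → HasSolution xs → HasSolution ys
  HasSolution-↭ p (us , s , sub , l , ws , d) =
    let vs , q , sub′ = ⊆-resp-↭ sub p in
    vs , s , sub′ , trans (sym (↭-length q)) l , WSum-resp-↭ q ws , d

  -- From c y = a x follows w x = (w a⁻¹ c) y, so unit weights for `xs` give unit weights for the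
  -- permuted `ys`.
  Equivalent⇒HasSolution : ∀ {l l′} {xs : Vec (ℤ/ n) l} {ys : Vec (ℤ/ n) l′} → Equivalent (U n) xs ys →
    HasZeroSumSubsequenceOfLength n (U n) xs → HasSolution (toList ys)
  Equivalent⇒HasSolution {xs = xs} {ys} (c , Uc , σ , a , Ua , eq) (I , ∣I∣ , _ , w , Uw , sum≡0) =
    subst HasSolution (cong toList (tabulate∘lookup ys)) (HasSolution-↭ (tabulate-permute σ (lookup ys))
      (zeroSum⇒HasSolution I v ∣I∣
        (λ i i∈I → Admissible-* {x = w i *ₙ a⁻¹ i} {c}
          (Admissible-* {x = w i} {a⁻¹ i} (U⇒Admissible (Uw i i∈I)) (U⇒Admissible (Ua⁻¹ i))) (U⇒Admissible Uc))
        (trans (cong (Vec.foldr′ _+ₙ_ (ι 0ℤ)) (tabulate-cong λ i → cong (if lookup I i then_else ι 0ℤ)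
          (trans (cong (v i *ₙ_) (lookup∘tabulate (λ i → lookup ys (σ ⟨$⟩ʳ i)) i)) (term i)))) sum≡0)))
    where
    a⁻¹ : Fin _ → ℤ/ n
    a⁻¹ i = proj₁ (Ua i)
    Ua⁻¹ : ∀ i → U n (a⁻¹ i)
    Ua⁻¹ i = a i , proj₂ (proj₂ (Ua i)) , proj₁ (proj₂ (Ua i))
    v : Fin _ → ℤ/ n
    v i = (w i *ₙ a⁻¹ i) *ₙ c
    term : ∀ i → v i *ₙ lookup ys (σ ⟨$⟩ʳ i) ≡ w i *ₙ lookup xs i
    term i = begin
      ((w i *ₙ a⁻¹ i) *ₙ c) *ₙ lookup ys (σ ⟨$⟩ʳ i)   ≡⟨ *ₙ-assoc (w i *ₙ a⁻¹ i) c _ ⟩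
      (w i *ₙ a⁻¹ i) *ₙ (c *ₙ lookup ys (σ ⟨$⟩ʳ i))   ≡⟨ cong ((w i *ₙ a⁻¹ i) *ₙ_) (eq i) ⟩
      (w i *ₙ a⁻¹ i) *ₙ (a i *ₙ lookup xs i)          ≡⟨ *ₙ-assoc (w i) (a⁻¹ i) _ ⟩
      w i *ₙ (a⁻¹ i *ₙ (a i *ₙ lookup xs i))          ≡⟨ cong (w i *ₙ_) (*ₙ-assoc (a⁻¹ i) (a i) _) ⟨
      w i *ₙ ((a⁻¹ i *ₙ a i) *ₙ lookup xs i)          ≡⟨ cong (λ u → w i *ₙ (u *ₙ lookup xs i)) (proj₁ (proj₂ (Ua i))) ⟩
      w i *ₙ (ι 1ℤ *ₙ lookup xs i)                    ≡⟨ cong (w i *ₙ_) (*ₙ-identityˡ _) ⟩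
      w i *ₙ lookup xs i                              ∎
      where open ≡-Reasoning

  -- The head of the standard sequence with the running product as an accumulator `P`, which permits
  -- recursion from the front.
  scaledHead : ∀ {r} → ℕ → Vec ℕ r → Vec ℤ r → List (ℤ/ n)
  scaledHead P [] [] = []
  scaledHead P (p ∷ ps) (b ∷ bs) = ι (+ P ℤ.* b) ∷ scaledHead (P * p) ps bs

  toList-head : ∀ {r} P (ps : Vec ℕ r) (bs : Vec ℤ r) →
    toList (tabulate λ i → ι {n} (+ (P * product (List.take (toℕ i) (toList ps))) ℤ.* lookup bs i)) ≡ scaledHead P ps bs
  toList-head P [] [] = refl
  toList-head P (p ∷ ps) (b ∷ bs) = cong₂ _∷_ (cong (λ Q → ι (+ Q ℤ.* b)) (*-identityʳ P))
    (trans (cong toList (tabulate-cong λ i → cong (λ Q → ι (+ Q ℤ.* lookup bs i))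
      (sym (*-assoc P p (product (List.take (toℕ i) (toList ps))))))) (toList-head (P * p) ps bs))

  scaledTail : ℕ → List (ℤ/ n)
  scaledTail m = List.replicate m (ι (+ (n / 2))) ++ List.replicate (n ∸ m) (ι 0ℤ)

  toList-standardSequence : ∀ {r} (ps : Vec ℕ r) (bs : Vec ℤ r) m →
    toList (standardSequence n ps bs m) ≡ scaledHead 1 ps bs ++ scaledTail m
  toList-standardSequence ps bs m = trans (toList-++ (tabulate λ i → ι (+ product (List.take (toℕ i) (toList ps)) ℤ.* lookup bs i)) _) (cong₂ _++_
    (trans (cong toList (tabulate-cong λ i → cong (λ Q → ι (+ Q ℤ.* lookup bs i))
      (sym (*-identityˡ (product (List.take (toℕ i) (toList ps))))))) (toList-head 1 ps bs))
    (trans (toList-++ (replicate m _) _) (cong₂ _++_ (toList-replicate m _) (toList-replicate (n ∸ m) _))))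

  head-∣ : ∀ {r d P} (ps : Vec ℕ r) (bs : Vec ℤ r) → d ∣ n → d ∣ P → All (d ∣ᶠ_) (scaledHead P ps bs)
  head-∣ [] [] d∣n d∣P = []
  head-∣ {d = d} {P = P} (p ∷ ps) (b ∷ bs) d∣n d∣P =
    ι-∣⁺ (+ P ℤ.* b) d∣n (subst (d ∣_) (sym (ℤ.abs-* (+ P) b)) (∣m⇒∣m*n ℤ.∣ b ∣ d∣P)) ∷ head-∣ ps bs d∣n (∣m⇒∣m*n p d∣P)

  -- Since `P * p` divides `n`, reduction modulo `n` does no harm: the residue is c P with c prime
  -- to `p`. Cancelling `P` leaves `p` dividing w c, although it divides neither factor.
  prime-step : ∀ {P p b} w → P * p ∣ n → Prime p → Coprime b (+ p) → Admissible {n} w →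
               ¬ P * p ∣ w * toℕ (ι {n} (+ P ℤ.* b))
  prime-step {P} {p} {b} w Pp∣n pr cop adm d
    with toℕ (ι {n} (+ P ℤ.* b)) in eq
       | ι-∣⁺ {n} {P} (+ P ℤ.* b) (m*n∣⇒m∣ P p Pp∣n) (subst (P ∣_) (sym (ℤ.abs-* (+ P) b)) (m∣m*n ℤ.∣ b ∣))
  ... | _ | divides c refl =
    [ adm pr (m*n∣⇒n∣ P p Pp∣n) , p∤c ]′ (euclidsLemma w c pr p∣wc)
    where
    instance P≢0 : NonZero P
    P≢0 = ≢-nonZero λ { refl → ≢-nonZero⁻¹ n (0∣⇒≡0 Pp∣n) }
    p∣wc : p ∣ w * c
    p∣wc = *-cancelˡ-∣ P (subst (P * p ∣_) (trans (sym (*-assoc w c P)) (*-comm (w * c) P)) d)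
    p∤c : ¬ p ∣ c
    p∤c p∣c = contradiction pr (subst (λ q → ¬ Prime q) (sym (cop (p∣b , ∣-refl))) ¬prime[1])
      where
      p∣b : p ∣ ℤ.∣ b ∣
      p∣b = *-cancelˡ-∣ P (subst (P * p ∣_) (ℤ.abs-* (+ P) b) (ι-∣⁻ {n} {P * p} (+ P ℤ.* b) Pp∣n
        (subst (P * p ∣_) (sym eq) (subst (_∣ c * P) (*-comm p P) (*-monoˡ-∣ P p∣c)))))

  -- P p divides n and all terms after P b, so P b cannot be used.
  skip-head : ∀ {r} P (ps : Vec ℕ r) (bs : Vec ℤ r) {tail ys s} →
    (∀ i → Prime (lookup ps i)) → (∀ i → Coprime (lookup bs i) (+ lookup ps i)) →
    P * product (toList ps) ∣ n → All (P * product (toList ps) ∣ᶠ_) tail →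
    ys ⊆ scaledHead P ps bs ++ tail → WSum (Admissible {n}) ys s → n ∣ s → ys ⊆ tail
  skip-head P [] [] prs cops d∣n d∣tail sub ws n∣s = sub
  skip-head P (p ∷ ps) (b ∷ bs) {tail} prs cops d∣n d∣tail (_ ∷ʳ sub) ws n∣s =
    skip-head (P * p) ps bs (prs ∘ suc) (cops ∘ suc) (subst (_∣ n) (sym assoc) d∣n)
      (subst (λ d → All (d ∣ᶠ_) tail) (sym assoc) d∣tail) sub ws n∣s
    where assoc = *-assoc P p (product (toList ps))
  skip-head P (p ∷ ps) (b ∷ bs) {tail} prs cops d∣n d∣tail (refl ∷ sub) (_∷_ {w = w} {s = s′} adm ws) n∣s =
    contradiction (∣m+n∣m⇒∣n (subst (P * p ∣_) (+-comm _ s′) (∣-trans Pp∣n n∣s)) (∣-WSum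
        (All-resp-⊆ sub (All-++⁺ (head-∣ ps bs Pp∣n ∣-refl) (All.map (∣-trans Pp∣d) d∣tail))) ws))
      (prime-step {P} {p} {b} w Pp∣n (prs zero) (cops zero) adm)
    where
    Pp∣d : P * p ∣ P * (p * product (toList ps))
    Pp∣d = subst (P * p ∣_) (*-assoc P p _) (m∣m*n (product (toList ps)))
    Pp∣n = ∣-trans Pp∣d d∣n

  module _ (2∣n : 2 ∣ n) where

    half : n ≡ 2 * (n / 2)
    half = sym (m*[n/m]≡n 2∣n)

    private instance half≢0 : NonZero (n / 2)
    half≢0 = ≢-nonZero λ h≡0 → ≢-nonZero⁻¹ n (trans half (cong (2 *_) h≡0))

    half∣n : n / 2 ∣ n
    half∣n = subst (n / 2 ∣_) (sym half) (n∣m*n 2)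

    toℕ-half : toℕ (ι {n} (+ (n / 2))) ≡ n / 2
    toℕ-half = trans (toℕ-ι (+ (n / 2))) (m<n⇒m%n≡m (m/n<m n 2 (s≤s (s≤s z≤n))))

    -- By `skip-head` the `n` chosen terms lie in the tail, which has exactly `n` terms, so all of
    -- it is taken. The odd number of terms n/2 then contradicts `WSum-parity` with `q` equal to
    -- n/2.
    standard-unsolvable : ∀ {r} (ps : Vec ℕ r) (bs : Vec ℤ r) m → (∀ i → Prime (lookup ps i)) →
      n ≡ 2 * product (toList ps) → (∀ i → Coprime (lookup bs i) (+ lookup ps i)) → ¬ 2 ∣ m → m ≤ n →
      ¬ HasSolution (toList (standardSequence n ps bs m))
    standard-unsolvable ps bs m prs n≡ cops 2∤m m≤n (ys , s , sub , l , ws , n∣s)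
      with skip-head 1 ps bs prs cops (subst (_∣ n) (sym prod≡half) half∣n)
             (subst (λ d → All (d ∣ᶠ_) (scaledTail m)) (sym prod≡half) (All-++⁺ V-∣ (replicate⁺ (n ∸ m) (ι-∣⁺ 0ℤ half∣n (_ ∣0)))))
             (subst (ys ⊆_) (toList-standardSequence ps bs m) sub) ws n∣s
      where
      V-∣ : All (n / 2 ∣ᶠ_) (List.replicate m (ι {n} (+ (n / 2))))
      V-∣ = replicate⁺ m (ι-∣⁺ (+ (n / 2)) half∣n ∣-refl)
      prod≡half : 1 * product (toList ps) ≡ n / 2
      prod≡half = trans (*-identityˡ _) (*-cancelˡ-≡ _ _ 2 (trans (sym n≡) half))
    ... | sub′ with refl ← Pointwise-≡⇒≡ (toPointwise (trans l (sym (trans (length-++ (List.replicate m (ι {n} (+ (n / 2)))))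
                  (trans (cong₂ _+_ (length-replicate m) (length-replicate (n ∸ m))) (m+[n∸m]≡n m≤n))))) sub′) =
      2∤m (subst (2 ∣_) (length-replicate m) (proj₁ (proj₂ (WSum-parity (n / 2) {V = List.replicate m (ι (+ (n / 2)))}
        (replicate⁺ m (ι-∣⁺ (+ (n / 2)) half∣n ∣-refl)) (replicate⁺ m ¬half)
        (replicate⁺ (n ∸ m) (ι-∣⁺ 0ℤ (∣-reflexive (sym half)) (_ ∣0)))
        (WSum-map (λ adm → adm prime[2] 2∣n) ws))) (subst (_∣ s) half n∣s)))
      where
      ¬half : ¬ 2 * (n / 2) ∣ᶠ ι {n} (+ (n / 2))
      ¬half d = <⇒≱ (m/n<m n 2 (s≤s (s≤s z≤n))) (∣⇒≤ (subst (_∣ n / 2) (sym half) (subst (2 * (n / 2) ∣_) toℕ-half d)))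

-- Prime powers and auxiliary facts.

prime-power-cancelʳ : ∀ {p q} a c → Prime q → ¬ q ∣ p → q ^ a ∣ c * p → q ^ a ∣ c
prime-power-cancelʳ zero c pr q∤p d = 1∣ c
prime-power-cancelʳ {p} {q} (suc a) c pr q∤p d with euclidsLemma c p pr (m*n∣⇒m∣ q (q ^ a) d)
... | inj₂ q∣p = contradiction q∣p q∤p
... | inj₁ (divides c′ refl) = subst (q * q ^ a ∣_) (*-comm q c′) (*-monoʳ-∣ q
    (prime-power-cancelʳ a c′ pr q∤p (*-cancelˡ-∣ q {{prime⇒nonZero pr}}
      (subst (q * q ^ a ∣_) (trans (cong (_* p) (*-comm c′ q)) (*-assoc q c′ p)) d))))

prime-power-*-∣ : ∀ {p q x} a → Prime q → ¬ q ∣ p → q ^ a ∣ x → p ∣ x → q ^ a * p ∣ x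
prime-power-*-∣ {p} a pr q∤p d (divides c refl) = *-monoˡ-∣ p (prime-power-cancelʳ a c pr q∤p d)

∸-suc : ∀ {m n} → n < m → m ∸ n ≡ suc (m ∸ suc n)
∸-suc {suc m} {zero} _ = refl
∸-suc {suc m} {suc n} (s≤s n<m) = ∸-suc n<m

All-≡⇒replicate : ∀ {A : Set} {a : A} {xs} → All (_≡ a) xs → xs ≡ List.replicate (length xs) a
All-≡⇒replicate [] = refl
All-≡⇒replicate (refl ∷ all) = cong (_ ∷_) (All-≡⇒replicate all)

∥∥≡suc⇒Nonempty : ∀ {l c} (I : Vec _ l) → ∥ I ∥ ≡ suc c → Nonempty I
∥∥≡suc⇒Nonempty (inside ∷ I) _ = zero , here
∥∥≡suc⇒Nonempty (outside ∷ I) eq = let i , i∈I = ∥∥≡suc⇒Nonempty I eq in suc i , there i∈I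

-- The case n = 2^r p

module _ {n p m : ℕ} .{{_ : NonZero n}} (k : ℕ) (pr : Prime p) (2∤p : ¬ 2 ∣ p)
  (n≡2^rp : n ≡ 2 ^ suc k * p) (2∣m : 2 ∣ m) (n≡4+m : n ≡ 4 + m) (1≤k : 1 ≤ k) where

  private
    r : ℕ
    r = suc k

    2^r∣n : 2 ^ r ∣ n
    2^r∣n = subst (2 ^ r ∣_) (sym n≡2^rp) (m∣m*n p)

    2∣n : 2 ∣ n
    2∣n = m*n∣⇒m∣ 2 (2 ^ k) 2^r∣n

    half≡ : n / 2 ≡ 2 ^ k * p
    half≡ = *-cancelˡ-≡ _ _ 2 (trans (sym (half 2∣n)) (trans n≡2^rp (*-assoc 2 (2 ^ k) p)))

    Level : ℕ → ℤ/ n → Set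
    Level j x = 2 ^ (r ∸ j) ∣ᶠ x

    Level-r : ∀ x → Level r x
    Level-r x = subst (λ j → 2 ^ j ∣ᶠ x) (sym (n∸n≡0 r)) (1∣ toℕ x)

  open Selection Level (λ j x → 2 ^ (r ∸ j) ∣? toℕ x)
    (λ x → ¬ p ∣ᶠ x) (λ x → ¬? (p ∣? toℕ x)) m 2∣m hiding (n)

  Balanced⇒WSum : ∀ {ys} → Balanced ys → ∃[ s ] WSum Odd ys s × 2 ^ r ∣ s
  Balanced⇒WSum {ys} (zeros all) = let s , ws = unweighted {P = Odd} 2∤1 ys in s , ws , ∣-WSum all ws
  Balanced⇒WSum (level j {a} (La ∷ LV) (¬La ∷ ¬LV) LH even) with suc j ≤? r
  -- By truncated subtraction 2^(r - j) is 1 here, and 1 divides `a`.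
  ... | no j≮r = contradiction (subst (λ i → 2 ^ i ∣ᶠ a) (sym (m≤n⇒m∸n≡0 (≮⇒≥ j≮r))) (1∣ toℕ a)) ¬La
  ... | yes j<r = WSum-balance (2 ^ (r ∸ suc j)) {{m^n≢0 2 (r ∸ suc j)}} r (La ∷ LV)
          (subst (λ i → All (λ x → ¬ i ∣ᶠ x) _) eq (¬La ∷ ¬LV)) (subst (λ i → All (i ∣ᶠ_) _) eq LH) even
    where
    eq : 2 ^ (r ∸ j) ≡ 2 * 2 ^ (r ∸ suc j)
    eq = cong (2 ^_) (∸-suc j<r)

  p∣-stable : ∀ {ys : List (ℤ/ n)} → All (λ x → ¬ ¬ p ∣ᶠ x) ys → All (p ∣ᶠ_) ys
  p∣-stable = All.map λ {x} → decidable-stable (p ∣? toℕ x)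

  Spread⇒WSum : ∀ {ys} → Spread ys → ∃[ s ] WSum (λ w → ¬ p ∣ w) ys s × p ∣ s
  Spread⇒WSum {ys} (inj₁ all) =
    let s , ws = unweighted {P = λ w → ¬ p ∣ w} (prime∤1 pr) ys in s , ws , ∣-WSum (p∣-stable all) ws
  Spread⇒WSum (inj₂ (x , y , p∤x , p∤y , s)) = WSum-spread pr 2∤p p∤x p∤y s

  CoprimeTo2p : ℕ → Set
  CoprimeTo2p w = ¬ 2 ∣ w × ¬ p ∣ w

  -- p v + 2^r w is a multiple of v modulo 2^r and of w modulo p, which makes the Chinese
  -- remainder theorem unnecessary.
  combine-weights : ∀ {v w} → Odd v → ¬ p ∣ w → CoprimeTo2p (p * v + 2 ^ r * w)
  combine-weights {v} {w} 2∤v p∤w =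
    (λ d → [ 2∤p , 2∤v ]′ (euclidsLemma p v prime[2]
      (∣m+n∣m⇒∣n (subst (2 ∣_) (+-comm (p * v) _) d) (∣m⇒∣m*n w (m∣m*n (2 ^ k)))))) ,
    (λ d → [ (λ p∣2^r → odd-prime∤2 pr 2∤p (prime∣^⇒∣ 2 r pr p∣2^r)) , p∤w ]′
      (euclidsLemma (2 ^ r) w pr (∣m+n∣m⇒∣n d (m∣m*n v))))

  CoprimeTo2p⇒U : ∀ {w} → CoprimeTo2p w → U n (w mod n)
  CoprimeTo2p⇒U {w} (2∤w , p∤w) = Solves⇒U {n} {w} (subst (λ q → Solves q w) (sym n≡2^rp)
    (Solves-* (Solves-^ r (prime∤⇒Solves prime[2] 2∤w)) (prime∤⇒Solves pr p∤w)))

  -- In the combined sum p s + 2^r t both summands are divisible by 2^r p, since 2^r divides s and p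
  -- divides t.
  Solvable⇒WSum : ∀ {ys} → Solvable ys → ∃[ s ] WSum CoprimeTo2p ys s × n ∣ s
  Solvable⇒WSum (bal , spr) with Balanced⇒WSum bal | Spread⇒WSum spr
  ... | s , vs , 2^r∣s | t , ws , p∣t = _ , WSum-combine p (2 ^ r) combine-weights vs ws ,
    subst (_∣ p * s + 2 ^ r * t) (sym n≡2^rp) (∣m∣n⇒∣m+n
      (subst (_∣ p * s) (*-comm p (2 ^ r)) (*-monoʳ-∣ p 2^r∣s)) (*-monoʳ-∣ (2 ^ r) p∣t))

  choice⇒zeroSum : ∀ {l} {xs : Vec (ℤ/ n) l} → Chosen Solvable (toList xs) → HasZeroSumSubsequenceOfLength n (U n) xs
  choice⇒zeroSum (ys , ys≼xs , c , sol) =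
    let vs , q , sub = ≼⇒⊆ ys≼xs
        s , ws , n∣s = Solvable⇒WSum sol
        I , a , ∣I∣ , adm , e = realise sub (WSum-resp-↭ q ws)
        ∣I∣≡n = trans ∣I∣ (trans (sym (↭-length q)) (trans c (sym n≡4+m)))
    in I , ∣I∣≡n , ∥∥≡suc⇒Nonempty I (trans ∣I∣≡n n≡4+m) , a ,
       (λ i i∈I → let w , cop , eq = adm i i∈I in subst (U n) (sym eq) (CoprimeTo2p⇒U cop)) ,
       toℕ-injective (trans e (trans (n∣m⇒m%n≡0 s n n∣s) (sym toℕ-0)))

  gao-upper : GaoProperty n (U n) (suc (n + r))
  gao-upper xs = choice⇒zeroSum (solvable-choice r (toList xs) (All.universal Level-r _)
    (≤-reflexive (trans (cong (λ j → suc (j + r)) (sym n≡4+m)) (sym (length-toList xs)))))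

  product-twos : ∀ j → product (toList (replicate j 2)) ≡ 2 ^ j
  product-twos zero = refl
  product-twos (suc j) = cong (2 *_) (product-twos j)

  -- The prime p comes first: the term prime to p opens the sequence, and the multiples of p follow
  -- by increasing 2-adic valuation.
  primes : Vec ℕ r
  primes = p ∷ replicate k 2

  primes-prime : ∀ i → Prime (lookup primes i)
  primes-prime zero = pr
  primes-prime (suc i) = subst Prime (sym (lookup-replicate i 2)) prime[2]

  n≡2primes : n ≡ 2 * product (toList primes)
  n≡2primes = trans n≡2^rp (trans (*-assoc 2 (2 ^ k) p) (cong (2 *_)
    (trans (*-comm (2 ^ k) p) (cong (p *_) (sym (product-twos k))))))

  standard-length : ∀ {j} → j ≤ n → r + (j + (n ∸ j)) ≡ n + r
  standard-length j≤n = trans (cong (λ i → r + i) (m+[n∸m]≡n j≤n)) (+-comm r n)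

  -- A standard sequence with all bᵢ = 1 and m = 1 has length n + r and no solution, hence neither
  -- has any initial segment of it.
  gao-lower : ∀ l → GaoProperty n (U n) l → suc (n + r) ≤ l
  gao-lower l gao with suc (n + r) ≤? l
  ... | yes n+r<l = n+r<l
  ... | no n+r≮l = contradiction
      (let I , ∣I∣ , _ , a , Ua , sum≡0 = gao (truncate l≤ std) in
       HasSolution-⊆ (truncate-⊆ l≤ std) (zeroSum⇒HasSolution I a ∣I∣ (λ i i∈I → U⇒Admissible (Ua i i∈I)) sum≡0))
      (standard-unsolvable 2∣n primes ones 1 primes-prime n≡2primes ones-coprime 2∤1 (>-nonZero⁻¹ n))
    where
    ones : Vec ℤ r
    ones = replicate r 1ℤ
    std = standardSequence n primes ones 1
    l≤ : l ≤ r + (1 + (n ∸ 1))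
    l≤ = ≤-trans (≤-pred (≰⇒> n+r≮l)) (≤-reflexive (sym (standard-length (>-nonZero⁻¹ n))))
    ones-coprime : ∀ i → Coprime (lookup ones i) (+ lookup primes i)
    ones-coprime i (d , _) = ∣1⇒≡1 (subst (λ b → _ ∣ ℤ.∣ b ∣) (lookup-replicate i 1ℤ) d)

  gaoConstant : IsGaoConstant n (U n) (suc (n + r))
  gaoConstant = s≤s z≤n , gao-upper , λ l _ → gao-lower l

  gaoConstant-unique : ∀ {E} → IsGaoConstant n (U n) E → E ≡ suc (n + r)
  gaoConstant-unique (_ , gao , least) = ≤-antisym (least _ (s≤s z≤n) gao-upper) (gao-lower _ gao)

  -- What is left of a standard sequence when `j` entries of its head remain: the running product
  -- has already absorbed p and r - 1 - j factors 2.
  StandardTail : ℕ → List (ℤ/ n) → Set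
  StandardTail j xs = Σ[ bs ∈ Vec ℤ j ] ∃[ t ] (∀ i → ¬ 2 ∣ ℤ.∣ lookup bs i ∣) × ¬ 2 ∣ t × t ≤ n ×
    xs ↭ scaledHead (2 ^ (r ∸ suc j) * p) (replicate j 2) bs ++ scaledTail t

  -- A term divisible by p on a known level is an odd multiple of a power of 2 times p, and the odd
  -- factor is taken as bᵢ. On the last level only n/2 and 0 are left.
  chain⇒standard : ∀ j {xs} → j < r → Chain j xs → All (p ∣ᶠ_) xs → StandardTail j xs
  chain⇒standard zero _ (last {V = V} {H} perm LV ¬LV LH odd l) all =
    [] , length V , (λ ()) , odd , subst (length V ≤_) V+H≡n (m≤m+n (length V) (length H)) ,
    ↭-trans perm (↭-reflexive (cong₂ _++_ (All-≡⇒replicate V-half)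
      (trans (All-≡⇒replicate H-zero) (cong (λ i → List.replicate i (ι 0ℤ))
        (trans (sym (m+n∸m≡n (length V) (length H))) (cong (_∸ length V) V+H≡n))))))
    where
    V+H≡n : length V + length H ≡ n
    V+H≡n = trans l (sym n≡4+m)
    p∣V = ++⁻ˡ V (All-resp-↭ perm all)
    p∣H = ++⁻ʳ V (All-resp-↭ perm all)
    is-half : ∀ {x : ℤ/ n} → Level 1 x × p ∣ᶠ x × ¬ Level 0 x → x ≡ ι (+ (n / 2))
    is-half {x} (Lx , p∣x , ¬Lx) with subst (_∣ toℕ x) (sym half≡) (prime-power-*-∣ k prime[2] 2∤p Lx p∣x)
    ... | divides 0 eq = contradiction (subst (2 ^ r ∣_) (sym eq) (_ ∣0)) ¬Lx
    ... | divides 1 eq = toℕ-injective (trans eq (trans (*-identityˡ (n / 2)) (sym (toℕ-half 2∣n))))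
    -- Twice n/2 already reaches `n`, but residues are smaller.
    ... | divides (suc (suc c)) eq = contradiction (toℕ<n x) (≤⇒≯ (begin
      n                       ≡⟨ half 2∣n ⟩
      2 * (n / 2)             ≤⟨ *-monoˡ-≤ (n / 2) (s≤s (s≤s (z≤n {c}))) ⟩
      suc (suc c) * (n / 2)   ≡⟨ eq ⟨
      toℕ x                   ∎))
      where open ≤-Reasoning
    is-zero : ∀ {x : ℤ/ n} → Level 0 x × p ∣ᶠ x → x ≡ ι 0ℤ
    is-zero {x} (Lx , p∣x) = toℕ-injective (trans (trans (sym (toℕ-% x)) (n∣m⇒m%n≡0 (toℕ x) n
      (subst (_∣ toℕ x) (sym n≡2^rp) (prime-power-*-∣ r prime[2] 2∤p Lx p∣x)))) (sym toℕ-0))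
    V-half : All (_≡ ι (+ (n / 2))) V
    V-half = All.map is-half (All.zip (LV , All.zip (p∣V , ¬LV)))
    H-zero : All (_≡ ι 0ℤ) H
    H-zero = All.map is-zero (All.zip (LH , p∣H))
  chain⇒standard (suc j) j<r (step {x = x} perm Lx ¬Lx ch) all with All-resp-↭ perm all
  ... | p∣x ∷ all′ with prime-power-*-∣ (r ∸ (2 + j)) prime[2] 2∤p Lx p∣x
                      | chain⇒standard j (<⇒≤ j<r) ch all′
  ...   | divides c eq | bs , t , odd , 2∤t , t≤n , perm′ =
    + c ∷ bs , t , (λ { zero → 2∤c ; (suc i) → odd i }) , 2∤t , t≤n ,
    ↭-trans perm (↭-trans (prep x perm′) (↭-reflexive (cong₂ (λ y Q → y ∷ scaledHead Q (replicate j 2) bs ++ scaledTail t)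
      x≡ (trans (cong (_* p) next) (trans (*-assoc 2 scale p) (*-comm 2 (scale * p)))))))
    where
    scale = 2 ^ (r ∸ (2 + j))
    next : 2 ^ (r ∸ suc j) ≡ 2 * scale
    next = cong (2 ^_) (∸-suc j<r)
    x≡ : x ≡ ι (+ (scale * p) ℤ.* + c)
    x≡ = trans (sym (ι-toℕ x)) (cong ι (trans (cong +_ (trans eq (*-comm c (scale * p)))) (ℤ.pos-* (scale * p) c)))
    2∤c : ¬ 2 ∣ c
    2∤c 2∣c = ¬Lx (subst₂ _∣_ (sym next) (sym eq) (*-pres-∣ 2∣c (m∣m*n {scale} p)))

  ¬OddClass⇒even : ∀ {x : ℤ/ n} → ¬ OddClass x → 2 ∣ᶠ x
  ¬OddClass⇒even {x} ¬odd = decidable-stable (2 ∣? toℕ x) λ 2∤x → ¬odd (+ toℕ x , 2∤x , ι-toℕ x)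

  OddClass⇒odd : ∀ {x : ℤ/ n} → OddClass x → ¬ 2 ∣ᶠ x
  OddClass⇒odd (z , 2∤z , refl) 2∣x = 2∤z (ι-∣⁻ z 2∣n 2∣x)

  2^[r∸k]≡2 : 2 ^ (r ∸ k) ≡ 2
  2^[r∸k]≡2 = cong (2 ^_) (m+n∸n≡m 1 k)

  Level-k : ∀ {x} → ¬ OddClass x → Level k x
  Level-k {x} ¬odd = subst (_∣ᶠ x) (sym 2^[r∸k]≡2) (¬OddClass⇒even ¬odd)

  not-Level-k : ∀ {x} → OddClass x → ¬ Level k x
  not-Level-k {x} odd d = OddClass⇒odd odd (subst (_∣ᶠ x) 2^[r∸k]≡2 d)

  -- As r ≥ 2, at least n terms remain beside the two odd ones, which is what `isolate` asks for.
  4+m≤ : ∀ {t} → n + r ≡ 2 + t → 4 + m ≤ t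
  4+m≤ {t} eq = +-cancelˡ-≤ 2 (4 + m) t (begin
    2 + (4 + m)   ≡⟨ cong (λ i → 2 + i) n≡4+m ⟨
    2 + n         ≡⟨ +-comm 2 n ⟩
    n + 2         ≤⟨ +-monoʳ-≤ n (s≤s 1≤k) ⟩
    n + r         ≡⟨ eq ⟩
    2 + t         ∎)
    where open ≤-Reasoning

  -- With the bᵢ read off from the terms themselves, the equivalence is a mere permutation, all
  -- units being 1.
  StandardForm : ∀ {l} → Vec (ℤ/ n) l → Set
  StandardForm S = Σ[ bs ∈ Vec ℤ r ] ∃[ t ] (∀ i → Coprime (lookup bs i) (+ lookup primes i)) × ¬ 2 ∣ t × t ≤ n ×
    toList S ↭ toList (standardSequence n primes bs t)

  -- All terms of `ys` are divisible by p, so a balanced choice among them would be solvable. Hence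
  -- there is none, `chain` applies to `ys`, and `z` itself serves as b₁.
  isolated⇒standard : ∀ {l z ys} (S : Vec (ℤ/ n) l) → l ≡ n + r → ¬ HasZeroSumSubsequenceOfLength n (U n) S →
    toList S ↭ z ∷ ys → ¬ p ∣ᶠ z → All (λ x → ¬ ¬ p ∣ᶠ x) ys → StandardForm S
  isolated⇒standard {z = z} {ys} S l≡ none perm p∤z p∣ys =
    let bs , t , odd , 2∤t , t≤n , perm′ = chain⇒standard k ≤-refl
          (chain k ys (All.universal Level-r ys) length-ys no-balanced) (p∣-stable p∣ys)
    in + toℕ z ∷ bs , t , coprime bs odd , 2∤t , t≤n ,
       ↭-trans perm (↭-trans (prep z perm′) (↭-reflexive (trans (head≡ bs t)
         (sym (toList-standardSequence primes (+ toℕ z ∷ bs) t)))))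
    where
    no-balanced : ¬ Chosen Balanced ys
    no-balanced (us , s , c , b) =
      none (choice⇒zeroSum (us , ≼-trans (≼-trans s (≼-++ʳ (z ∷ []))) (≼-reflexive perm) , c , b , inj₁ (All-≼ s p∣ys)))
    length-ys : length ys ≡ 4 + m + k
    length-ys = suc-injective (trans (sym (↭-length perm)) (trans (length-toList S)
      (trans l≡ (trans (+-suc n k) (cong (λ i → suc (i + k)) n≡4+m)))))
    head≡ : ∀ (bs : Vec ℤ k) t → z ∷ scaledHead (2 ^ (r ∸ suc k) * p) (replicate k 2) bs ++ scaledTail t ≡
            scaledHead 1 primes (+ toℕ z ∷ bs) ++ scaledTail t
    head≡ bs t = cong₂ (λ y Q → y ∷ scaledHead Q (replicate k 2) bs ++ scaledTail t)
      (trans (sym (ι-toℕ z)) (cong ι (sym (ℤ.*-identityˡ (+ toℕ z))))) (cong (λ i → 2 ^ i * p) (n∸n≡0 k))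
    coprime : ∀ (bs : Vec ℤ k) → (∀ i → ¬ 2 ∣ ℤ.∣ lookup bs i ∣) →
              ∀ i → Coprime (lookup (+ toℕ z ∷ bs) i) (+ lookup primes i)
    coprime bs odd zero = prime∤⇒coprime pr p∤z
    coprime bs odd (suc i) = subst (λ q → Coprime (lookup bs i) (+ q)) (sym (lookup-replicate i 2))
      (prime∤⇒coprime prime[2] (odd i))

  -- `Level r` always holds and `Level k` is evenness, so the two odd terms form the lowest level,
  -- to which `isolate` applies.
  extremal⇒standard : ∀ {l} (S : Vec (ℤ/ n) l) → HasExactly 2 OddClass S → l ≡ n + r →
    ¬ HasZeroSumSubsequenceOfLength n (U n) S → StandardForm S
  extremal⇒standard S (I , ∣I∣ , iff) l≡ none with separate {P = OddClass} I S iff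
  ... | [] , _ , _ , c , _ = contradiction (trans c ∣I∣) λ ()
  ... | _ ∷ [] , _ , _ , c , _ = contradiction (trans c ∣I∣) λ ()
  ... | _ ∷ _ ∷ _ ∷ _ , _ , _ , c , _ = contradiction (trans c ∣I∣) λ ()
  ... | x ∷ y ∷ [] , T , perm , _ , odd-x ∷ odd-y ∷ [] , ¬oddT =
    let z , ys , perm′ , p∤z , p∣ys = isolate k perm (Level-r x) (Level-r y) (not-Level-k odd-x) (not-Level-k odd-y)
          (All.map Level-k ¬oddT) (4+m≤ (trans (sym l≡) (trans (sym (length-toList S)) (↭-length perm))))
          (λ c → none (choice⇒zeroSum c))
    in isolated⇒standard S l≡ none perm′ p∤z p∣ys

  Standard : ∀ {l} → Vec (ℤ/ n) l → Set
  Standard S = Σ[ ps ∈ Vec ℕ r ] Σ[ bs ∈ Vec ℤ r ] Σ[ t ∈ ℕ ]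
    ((i : Fin r) → Prime (lookup ps i)) × n ≡ 2 * product (toList ps) ×
    ((i : Fin r) → Coprime (lookup bs i) (+ (lookup ps i))) ×
    ¬ (2 ∣ t) × 1 ≤ t × t ≤ n × Equivalent (U n) S (standardSequence n ps bs t)

  extremal⇔standard : ∀ {l} (S : Vec (ℤ/ n) l) → HasExactly 2 OddClass S → IsGaoExtremal (U n) S ⇔ Standard S
  extremal⇔standard {l} S two-odd = mk⇔ to from
    where
    to : IsGaoExtremal (U n) S → Standard S
    to (E , isGao , l≡ , none) =
      let bs , t , cop , 2∤t , t≤n , perm = extremal⇒standard S two-odd
            (trans l≡ (cong (_∸ 1) (gaoConstant-unique isGao))) none
          σ , eq = ↭⇒permutation {xs = S} perm
      in primes , bs , t , primes-prime , n≡2primes , cop , 2∤t ,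
         n≢0⇒n>0 (λ t≡0 → 2∤t (subst (2 ∣_) (sym t≡0) (2 ∣0))) , t≤n ,
         (ι 1ℤ , U-1 , σ , (λ _ → ι 1ℤ) , (λ _ → U-1) , λ i → cong (ι 1ℤ *ₙ_) (eq i))
    from : Standard S → IsGaoExtremal (U n) S
    from (ps , bs , t , prs , n≡ , cops , 2∤t , _ , t≤n , equiv@(_ , _ , σ , _)) =
      suc (n + r) , gaoConstant , trans (↔⇒≡ σ) (standard-length t≤n) ,
      λ zs → standard-unsolvable 2∣n ps bs t prs n≡ cops 2∤t t≤n (Equivalent⇒HasSolution {xs = S} equiv zs)

theorem5 : ∀ (n r p : ℕ) .{{_ : NonZero n}} →
    Prime p → ¬ (2 ∣ p) → 2 ≤ r → n ≡ 2 ^ r * p →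
    ∀ {l : ℕ} (S : Vec (ℤ/ n) l) → HasExactly 2 OddClass S →
    IsGaoExtremal (U n) S
    ⇔
    (Σ[ ps ∈ Vec ℕ r ] Σ[ bs ∈ Vec ℤ r ] Σ[ m ∈ ℕ ]
    ((i : Fin r) → Prime (lookup ps i)) ×
    n ≡ 2 * product (toList ps) ×
    ((i : Fin r) → Coprime (lookup bs i) (+ (lookup ps i))) ×
    ¬ (2 ∣ m) × 1 ≤ m × m ≤ n ×
    Equivalent (U n) S (standardSequence n ps bs m))
theorem5 n (suc (suc k)) p pr 2∤p (s≤s (s≤s z≤n)) n≡ S =
  extremal⇔standard (suc k) pr 2∤p n≡ 2∣n∸4 (sym (m+[n∸m]≡n 4≤n)) (s≤s z≤n) S
  where
  -- From r ≥ 2 it follows that 4 divides n, so n = 4 + m with m even.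
  4∣n : 4 ∣ n
  4∣n = subst (4 ∣_) (sym n≡) (∣m⇒∣m*n p (subst (4 ∣_) (*-assoc 2 2 (2 ^ k)) (m∣m*n (2 ^ k))))
  4≤n : 4 ≤ n
  4≤n = ∣⇒≤ 4∣n
  2∣n∸4 : 2 ∣ n ∸ 4
  2∣n∸4 = ∣m+n∣m⇒∣n (subst (2 ∣_) (sym (m+[n∸m]≡n 4≤n)) (∣-trans (divides 2 refl) 4∣n)) (divides 2 refl)
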